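{- Let $G$ be a nontrivial connected graph and let $n\geq 3$ be an integer. If $n^2\lambda'(G)>n\,\xi(G)+2(n-1)$, then the direct product $G\times T_n$ is super restricted edge-connected (super-$\lambda'$).
   Context: $G$ is a finite simple graph; it is nontrivial if it has at least two vertices. The total graph $T_n$ is the graph obtained from the complete graph $K_n$ on $n$ vertices by adding a loop at each vertex, so any two (possibly equal) vertices of $T_n$ are adjacent. For an edge $uv\in E(G)$ its edge-degree is $d_G(u)+d_G(v)-2$, and the minimum edge-degree is $\xi(G)=\min\{d_G(u)+d_G(v)-2: uv\in E(G)\}$. For a graph $H$, an edge subset $F\subseteq E(H)$ is an edge-cut if $H-F$ (delete the edges in $F$, keep all vertices) is disconnected. A restricted edge-cut of $H$ is an edge-cut $F$ such that every component of $H-F$ has at least two vertices (equivalently, $H-F$ is disconnected and has no isolated vertices). The restricted edge-connectivity $\lambda'(H)$ is the cardinality of a minimum (i.e. smallest-cardinality) restricted edge-cut of $H$ if $H$ has a restricted edge-cut, and $\lambda'(H)=+\infty$ otherwise (so an inequality $n^2\lambda'(G)>c$ with finite $c$ holds when $\lambda'(G)=+\infty$). $H$ is super restricted edge-connected (super-$\lambda'$) if every minimum restricted edge-cut $F$ of $H$ isolates an edge from $H$, i.e. some component of $H-F$ consists of exactly two vertices joined by an edge. The direct product $G_1\times G_2$ has vertex set $V(G_1)\times V(G_2)$, with $(u_1,v_1)$ adjacent to $(u_2,v_2)$ if and only if $u_1u_2\in E(G_1)$ and $v_1v_2\in E(G_2)$ (where $vv\in E(G_2)$ means there is a loop at $v$).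 -}

module Defs where

open import Data.Fin using (Fin)
import Data.Fin.Properties as Fin
open import Data.List using (List; map; allFin; filter; length; cartesianProduct)
open import Data.Nat using (ℕ; _+_; _*_; _∸_; _≤_; _<_)
open import Data.Product using (_×_; _,_; ∃; ∃₂)
import Data.Product as Product
open import Data.Product.Function.NonDependent.Propositional using (_×-↔_)
open import Data.Sum using (_⊎_)
import Data.Sum as Sum
open import Function using (_∘_; _↔_; Inverse)
open import Function.Construct.Composition using (_↔-∘_)
open import Function.Construct.Identity using (↔-id)
open import Function.Construct.Symmetry using (↔-sym)
open import Function.Properties.Inverse using (↔⇒↣)
open import Level using (0ℓ)
open import Relation.Binary using (Rel; Decidable; Symmetric; DecidableEquality)
open import Relation.Binary.Construct.Closure.ReflexiveTransitive using (Star)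
open import Relation.Binary.PropositionalEquality using (_≡_; _≢_; sym; ≢-sym)
open import Relation.Nullary using (¬_)
open import Relation.Nullary.Decidable using (_×-dec_; _⊎-dec_; ¬?)
open import Relation.Nullary.Construct.Add.Supremum public using (_⁺; ⊤⁺; [_])
open import Relation.Binary.Construct.Add.Supremum.Strict _<_ public using (_<⁺_)
open import Relation.Unary using (Pred; _≐_; _∪_; ｛_｝)

-- Finite undirected graphs without multiple edges, in which loops are allowed.
-- Adjacency is only ever used through inhabitation, so having several proofs
-- of `Adj u v` does not mean having parallel edges.
record Graph : Set₁ where
  field
    Vertex  : Set
    order   : ℕ
    enum    : Vertex ↔ Fin order
    Adj     : Rel Vertex 0ℓ
    adj-sym : Symmetric Adj
    adj?    : Decidable Adj

  index : Vertex → Fin order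
  index = Inverse.to enum

  vertices : List Vertex
  vertices = map (Inverse.from enum) (allFin order)

  _≟ᵛ_ : DecidableEquality Vertex
  _≟ᵛ_ = Fin.inj⇒≟ (↔⇒↣ enum)

open Graph using (Vertex; order; Adj; adj-sym; adj?; index; vertices)

Simple : Graph → Set
Simple G = ∀ {u} → ¬ Adj G u u

Nontrivial : Graph → Set
Nontrivial G = 2 ≤ order G

Reachable : (G : Graph) → Rel (Vertex G) 0ℓ
Reachable G = Star (Adj G)

Connected : Graph → Set
Connected G = ∀ u v → Reachable G u v

Disconnected : Graph → Set
Disconnected G = ∃₂ λ u v → ¬ Reachable G u v

-- The vertex set of the component containing the given vertex.
Component : (G : Graph) → Vertex G → Pred (Vertex G) 0ℓ
Component G x = Reachable G x

-- For simple graphs only: a loop would be counted once.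
degree : (G : Graph) → Vertex G → ℕ
degree G u = length (filter (adj? G u) (vertices G))

-- The subtraction does not truncate on the edges of a simple graph.
edgeDegree : (G : Graph) → Vertex G → Vertex G → ℕ
edgeDegree G u v = degree G u + degree G v ∸ 2

-- k = ξ(G)
IsMinEdgeDegree : Graph → ℕ → Set
IsMinEdgeDegree G k =
  (∃₂ λ u v → Adj G u v × edgeDegree G u v ≡ k) ×
  (∀ {u v} → Adj G u v → k ≤ edgeDegree G u v)

record EdgeSet (H : Graph) : Set₁ where
  field
    Mem     : Rel (Vertex H) 0ℓ
    mem-sym : Symmetric Mem
    mem?    : Decidable Mem
    mem⇒adj : ∀ {u v} → Mem u v → Adj H u v

open EdgeSet

-- Each undirected edge {u , v} is counted once, as the ordered pair whose
-- first component comes first in the enumeration.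
∣_∣ : {H : Graph} → EdgeSet H → ℕ
∣_∣ {H} F = length (filter
  (λ (u , v) → (index H u Fin.≤? index H v) ×-dec mem? F u v)
  (cartesianProduct (vertices H) (vertices H)))

infixl 6 _∖_

_∖_ : (H : Graph) → EdgeSet H → Graph
H ∖ F = record
  { Vertex  = Vertex H
  ; order   = order H
  ; enum    = Graph.enum H
  ; Adj     = λ u v → Adj H u v × ¬ Mem F u v
  ; adj-sym = Product.map (adj-sym H) (_∘ mem-sym F)
  ; adj?    = λ u v → adj? H u v ×-dec ¬? (mem? F u v)
  }

IsEdgeCut : (H : Graph) → EdgeSet H → Set
IsEdgeCut H F = Disconnected (H ∖ F)

IsRestrictedEdgeCut : (H : Graph) → EdgeSet H → Set
IsRestrictedEdgeCut H F =
  IsEdgeCut H F ×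
  (∀ x → ∃₂ λ y z → y ≢ z × Component (H ∖ F) x y × Component (H ∖ F) x z)

IsMinRestrictedEdgeCut : (H : Graph) → EdgeSet H → Set₁
IsMinRestrictedEdgeCut H F =
  IsRestrictedEdgeCut H F × (∀ F′ → IsRestrictedEdgeCut H F′ → ∣ F ∣ ≤ ∣ F′ ∣)

-- `IsRestrictedEdgeConnectivity H l` says l = λ′(H), where ⊤⁺ plays +∞.
data IsRestrictedEdgeConnectivity (H : Graph) : ℕ ⁺ → Set₁ where
  finite   : ∀ F → IsMinRestrictedEdgeCut H F →
             IsRestrictedEdgeConnectivity H [ ∣ F ∣ ]
  infinite : (∀ F → ¬ IsRestrictedEdgeCut H F) →
             IsRestrictedEdgeConnectivity H ⊤⁺

infixr 7 _·⁺_

-- Only meant for a positive scalar, where k · (+∞) = +∞.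
_·⁺_ : ℕ → ℕ ⁺ → ℕ ⁺
k ·⁺ [ l ] = [ k * l ]
k ·⁺ ⊤⁺    = ⊤⁺

IsolatesEdge : (H : Graph) → EdgeSet H → Set
IsolatesEdge H F = ∃ λ x → ∃₂ λ u v →
  u ≢ v × Adj (H ∖ F) u v × (Component (H ∖ F) x ≐ ｛ u ｝ ∪ ｛ v ｝)

SuperRestrictedEdgeConnected : Graph → Set₁
SuperRestrictedEdgeConnected H =
  ∀ F → IsMinRestrictedEdgeCut H F → IsolatesEdge H F

complete : ℕ → Graph
complete n = record
  { Vertex  = Fin n
  ; order   = n
  ; enum    = ↔-id (Fin n)
  ; Adj     = _≢_
  ; adj-sym = ≢-sym
  ; adj?    = λ u v → ¬? (u Fin.≟ v)
  }

addLoops : Graph → Graph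
addLoops H = record
  { Vertex  = Vertex H
  ; order   = order H
  ; enum    = Graph.enum H
  ; Adj     = λ u v → Adj H u v ⊎ u ≡ v
  ; adj-sym = Sum.map (adj-sym H) sym
  ; adj?    = λ u v → adj? H u v ⊎-dec Graph._≟ᵛ_ H u v
  }

-- T_n
total : ℕ → Graph
total n = addLoops (complete n)

infixr 7 _⊗_

-- The direct product.
_⊗_ : Graph → Graph → Graph
G ⊗ H = record
  { Vertex  = Vertex G × Vertex H
  ; order   = order G * order H
  ; enum    = ↔-sym Fin.*↔× ↔-∘ (Graph.enum G ×-↔ Graph.enum H)
  ; Adj     = λ (u₁ , v₁) (u₂ , v₂) → Adj G u₁ u₂ × Adj H v₁ v₂
  ; adj-sym = Product.map (adj-sym G) (adj-sym H)
  ; adj?    = λ (u₁ , v₁) (u₂ , v₂) → adj? G u₁ u₂ ×-dec adj? H v₁ v₂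
  }

{-# OPTIONS --safe #-}
-- The graph H = G × T_n replaces every vertex of G by a fibre of n independent
-- vertices and every edge of G by a K_{n,n}.  Let F be a minimum restricted
-- edge-cut of H, χ the indicator of a component of H − F, and let a x and b x
-- count the vertices of each colour in the fibre of x, so that a x + b x = n.
-- Isolating an edge of H over an edge of G of minimum edge-degree shows
-- |F| ≤ nξ + 2(n−1), while |F| is at least the sum over the edges xy of G of
-- a x · b y + b x · a y.  Call x split if a x, b x > 0.
--
-- If two adjacent vertices u, v are split, their incident edges alone contribute
-- n(d(u) + d(v)) − 2 ≥ nξ + 2(n−1).  Equality forces a u = a v = 1 and a = 0
-- elsewhere (or the same for b), so one colour class is an isolated edge.
--
-- Otherwise, a monochromatic x without neighbour of its own colour would have a
-- split neighbour, and the edges at these two would contribute too much.  Hence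
-- every slice {x : χ (x , i)} has a restricted edge-cut of G as boundary.  Each
-- edge of G has a monochromatic end, so the n boundaries, weighted by n, add up
-- to the bound above, giving |F| ≥ n²λ′(G), against the hypothesis.
module Submission where

open import Defs
open import Data.Nat using (ℕ; _+_; _*_; _∸_; _^_; _≤_)
open import Algebra.Properties.Semiring.Sum as Sum using ()
open import Data.Bool using (Bool; true; false; not; _xor_; if_then_else_; _∧_; _∨_)
import Data.Bool.Properties as Bool
open import Data.Empty using (⊥; ⊥-elim)
open import Data.Fin as Fin using (Fin; zero; suc; combine; _↑ˡ_; _↑ʳ_)
import Data.Fin.Properties as Fin
open import Data.List using (map; filter; length; cartesianProduct; tabulate; _++_)
import Data.List.Properties as List
open import Data.Nat using (zero; suc; _<_; z≤n; s≤s; z<s; >-nonZero)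
open import Data.Nat.Properties
open import Data.Nat.Tactic.RingSolver using (solve-∀)
open import Data.Product using (_×_; _,_; ∃; ∃₂; proj₁; proj₂)
open import Data.Sum using (_⊎_; inj₁; inj₂)
open import Function using (_∘_; Inverse)
open import Level using (0ℓ)
open import Relation.Binary.Construct.Add.Supremum.Strict _<_ using ([<]-injective)
open import Relation.Binary.Construct.Closure.ReflexiveTransitive using (ε; _◅_; _◅◅_)
open import Relation.Binary.PropositionalEquality
open import Relation.Nullary using (¬_; Dec; yes; no; does; contradiction)
open import Relation.Nullary.Decidable using (dec-true; dec-false; decidable-stable; _×-dec_; ¬?)
open import Relation.Unary using (Pred; Decidable; _∪_; ｛_｝)

open Graph using (Vertex; order; Adj; adj-sym; adj?; index; vertices; enum; _≟ᵛ_)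
open EdgeSet
open Sum +-*-semiring using (sum; sum-cong-≗; ∑-distrib-+; ∑-comm; *-distribˡ-sum; *-distribʳ-sum)

-- Finite sums of natural numbers

sum-mono : ∀ {n} {f g : Fin n → ℕ} → (∀ i → f i ≤ g i) → sum f ≤ sum g
sum-mono {zero}  f≤g = z≤n
sum-mono {suc n} f≤g = +-mono-≤ (f≤g zero) (sum-mono (f≤g ∘ suc))

-- No term can make up for slack in another one. This rigidity later extracts the equality case of
-- the bound for a split edge.
sum-mono-≡ : ∀ {n} {f g : Fin n → ℕ} → (∀ i → f i ≤ g i) → sum g ≤ sum f →
             ∀ i → f i ≡ g i
sum-mono-≡ {suc n} {f} {g} f≤g Σg≤Σf = λ
  { zero    → ≤-antisym (f≤g zero)
      (+-cancelʳ-≤ (sum (g ∘ suc)) (g zero) (f zero)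
        (≤-trans Σg≤Σf (+-monoʳ-≤ (f zero) (sum-mono (f≤g ∘ suc)))))
  ; (suc i) → sum-mono-≡ (f≤g ∘ suc)
      (+-cancelˡ-≤ (g zero) (sum (g ∘ suc)) (sum (f ∘ suc))
        (≤-trans Σg≤Σf (+-monoˡ-≤ (sum (f ∘ suc)) (f≤g zero)))) i
  }

sum-zero : ∀ {n} {f : Fin n → ℕ} → (∀ i → f i ≡ 0) → sum f ≡ 0
sum-zero {zero}  f≡0 = refl
sum-zero {suc n} f≡0 = cong₂ _+_ (f≡0 zero) (sum-zero (f≡0 ∘ suc))

sum-const : ∀ n c → sum {n} (λ _ → c) ≡ n * c
sum-const zero    c = refl
sum-const (suc n) c = cong (c +_) (sum-const n c)

sum-single : ∀ {n} {f : Fin n → ℕ} i → (∀ j → j ≢ i → f j ≡ 0) → sum f ≡ f i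
sum-single {suc n} {f} zero    f≡0 =
  trans (cong (f zero +_) (sum-zero (λ j → f≡0 (suc j) λ ()))) (+-identityʳ _)
sum-single {suc n} {f} (suc i) f≡0 =
  cong₂ _+_ (f≡0 zero λ ())
    (sum-single i (λ j j≢i → f≡0 (suc j) (j≢i ∘ Fin.suc-injective)))

sum-++ : ∀ m {n} (f : Fin (m + n) → ℕ) →
         sum f ≡ sum (λ i → f (i ↑ˡ n)) + sum (λ j → f (m ↑ʳ j))
sum-++ zero    f = refl
sum-++ (suc m) f = trans (cong (f zero +_) (sum-++ m (f ∘ suc))) (sym (+-assoc (f zero) _ _))

-- The vertices of a product graph are numbered through `combine`, so this is what breaks a sum over
-- the product into sums over fibres.
sum-combine : ∀ m n (f : Fin (m * n) → ℕ) →
              sum f ≡ sum (λ i → sum (λ j → f (combine {m} {n} i j)))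
sum-combine zero    n f = refl
sum-combine (suc m) n f = trans (sum-++ n f)
  (cong (sum (λ j → f (j ↑ˡ (m * n))) +_) (sum-combine m n (λ k → f (n ↑ʳ k))))

sum-* : ∀ {m n} (f : Fin m → ℕ) (g : Fin n → ℕ) →
        sum (λ i → sum (λ j → f i * g j)) ≡ sum f * sum g
sum-* f g = trans (sum-cong-≗ (λ i → sym (*-distribˡ-sum (f i) g)))
                  (sym (*-distribʳ-sum (sum g) f))

-- Zero-one indicators

𝟙 : Bool → ℕ
𝟙 b = if b then 1 else 0

𝟙-∧ : ∀ x y → 𝟙 (x ∧ y) ≡ 𝟙 x * 𝟙 y
𝟙-∧ true  y = sym (+-identityʳ _)
𝟙-∧ false y = refl

≤?-once : ∀ {n} {i j : Fin n} → i ≢ j → 𝟙 (does (i Fin.≤? j)) + 𝟙 (does (j Fin.≤? i)) ≡ 1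
≤?-once {i = i} {j} i≢j with Fin.≤-total i j
... | inj₁ i≤j = cong₂ _+_ (cong 𝟙 (dec-true (i Fin.≤? j) i≤j))
                           (cong 𝟙 (dec-false (j Fin.≤? i) (λ j≤i → i≢j (Fin.≤-antisym i≤j j≤i))))
... | inj₂ j≤i = cong₂ _+_ (cong 𝟙 (dec-false (i Fin.≤? j) (λ i≤j → i≢j (Fin.≤-antisym i≤j j≤i))))
                           (cong 𝟙 (dec-true (j Fin.≤? i) j≤i))

-- Sums over vertices and over ordered pairs of vertices

Σᵥ : (K : Graph) → (Vertex K → ℕ) → ℕ
Σᵥ K f = sum (f ∘ Inverse.from (enum K))

Σ² : (K : Graph) → (Vertex K → Vertex K → ℕ) → ℕ
Σ² K w = Σᵥ K λ x → Σᵥ K (w x)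

length-filter-tabulate : ∀ {A : Set} {P : Pred A 0ℓ} (P? : Decidable P) {n} (f : Fin n → A) →
  length (filter P? (tabulate f)) ≡ sum (λ i → 𝟙 (does (P? (f i))))
length-filter-tabulate P? {zero}  f = refl
length-filter-tabulate P? {suc n} f with does (P? (f zero))
... | true  = cong suc (length-filter-tabulate P? (f ∘ suc))
... | false = length-filter-tabulate P? (f ∘ suc)

length-filter-product : ∀ {A B : Set} {P : Pred (A × B) 0ℓ} (P? : Decidable P) {m n} (f : Fin m → A) (g : Fin n → B) →
  length (filter P? (cartesianProduct (tabulate f) (tabulate g))) ≡
  sum (λ i → sum (λ j → 𝟙 (does (P? (f i , g j)))))
length-filter-product P? {zero}  f g = refl
length-filter-product P? {suc m} f g = begin
  length (filter P? (map (f zero ,_) (tabulate g) ++ rest))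
    ≡⟨ cong length (List.filter-++ P? (map (f zero ,_) (tabulate g)) rest) ⟩
  length (filter P? (map (f zero ,_) (tabulate g)) ++ filter P? rest)
    ≡⟨ List.length-++ (filter P? (map (f zero ,_) (tabulate g))) ⟩
  length (filter P? (map (f zero ,_) (tabulate g))) + length (filter P? rest)
    ≡⟨ cong₂ _+_
        (trans (cong (length ∘ filter P?) (List.map-tabulate g (f zero ,_)))
               (length-filter-tabulate P? (λ j → f zero , g j)))
        (length-filter-product P? (f ∘ suc) g) ⟩
  sum (λ j → 𝟙 (does (P? (f zero , g j)))) + sum (λ i → sum (λ j → 𝟙 (does (P? (f (suc i) , g j))))) ∎
  where
  open ≡-Reasoning
  rest = cartesianProduct (tabulate (f ∘ suc)) (tabulate g)

module _ (K : Graph) where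

  private
    V = Vertex K
    from = Inverse.from (enum K)

    from-index : ∀ x → from (index K x) ≡ x
    from-index = Inverse.strictlyInverseʳ (enum K)

    index-from : ∀ i → index K (from i) ≡ i
    index-from = Inverse.strictlyInverseˡ (enum K)

  index-injective : ∀ {x y} → index K x ≡ index K y → x ≡ y
  index-injective {x} {y} eq = trans (sym (from-index x)) (trans (cong from eq) (from-index y))

  any-vertex? : {P : Pred V 0ℓ} → Decidable P → Dec (∃ P)
  any-vertex? {P} P? with Fin.any? (P? ∘ from)
  ... | yes (i , p) = yes (from i , p)
  ... | no ¬p       = no λ (x , p) → ¬p (index K x , subst P (sym (from-index x)) p)

  vertices-tabulate : vertices K ≡ tabulate from
  vertices-tabulate = List.map-tabulate (λ i → i) from

  Σᵥ-cong : {f g : V → ℕ} → (∀ x → f x ≡ g x) → Σᵥ K f ≡ Σᵥ K g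
  Σᵥ-cong f≡g = sum-cong-≗ (f≡g ∘ from)

  Σᵥ-mono : {f g : V → ℕ} → (∀ x → f x ≤ g x) → Σᵥ K f ≤ Σᵥ K g
  Σᵥ-mono f≤g = sum-mono (f≤g ∘ from)

  Σᵥ-mono-≡ : {f g : V → ℕ} → (∀ x → f x ≤ g x) → Σᵥ K g ≤ Σᵥ K f → ∀ x → f x ≡ g x
  Σᵥ-mono-≡ {f} {g} f≤g Σg≤Σf x =
    subst (λ y → f y ≡ g y) (from-index x) (sum-mono-≡ (f≤g ∘ from) Σg≤Σf (index K x))

  Σᵥ-+ : (f g : V → ℕ) → Σᵥ K (λ x → f x + g x) ≡ Σᵥ K f + Σᵥ K g
  Σᵥ-+ f g = ∑-distrib-+ (f ∘ from) (g ∘ from)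

  Σᵥ-* : ∀ c (f : V → ℕ) → Σᵥ K (λ x → c * f x) ≡ c * Σᵥ K f
  Σᵥ-* c f = sym (*-distribˡ-sum c (f ∘ from))

  Σ²-cong : {f g : V → V → ℕ} → (∀ x y → f x y ≡ g x y) → Σ² K f ≡ Σ² K g
  Σ²-cong f≡g = Σᵥ-cong (Σᵥ-cong ∘ f≡g)

  Σ²-mono : {f g : V → V → ℕ} → (∀ x y → f x y ≤ g x y) → Σ² K f ≤ Σ² K g
  Σ²-mono f≤g = Σᵥ-mono (Σᵥ-mono ∘ f≤g)

  Σ²-mono-≡ : {f g : V → V → ℕ} → (∀ x y → f x y ≤ g x y) → Σ² K g ≤ Σ² K f →
              ∀ x y → f x y ≡ g x y
  Σ²-mono-≡ f≤g Σg≤Σf x =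
    Σᵥ-mono-≡ (f≤g x) (≤-reflexive (sym (Σᵥ-mono-≡ (λ x → Σᵥ-mono (f≤g x)) Σg≤Σf x)))

  Σ²-+ : (f g : V → V → ℕ) → Σ² K (λ x y → f x y + g x y) ≡ Σ² K f + Σ² K g
  Σ²-+ f g = trans (Σᵥ-cong (λ x → Σᵥ-+ (f x) (g x))) (Σᵥ-+ (λ x → Σᵥ K (f x)) (λ x → Σᵥ K (g x)))

  Σ²-* : ∀ c (f : V → V → ℕ) → Σ² K (λ x y → c * f x y) ≡ c * Σ² K f
  Σ²-* c f = trans (Σᵥ-cong (λ x → Σᵥ-* c (f x))) (Σᵥ-* c (λ x → Σᵥ K (f x)))

  Σ²-comm : (f : V → V → ℕ) → Σ² K f ≡ Σ² K (λ x y → f y x)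
  Σ²-comm f = ∑-comm (λ i j → f (from i) (from j))

  δ : V → V → ℕ
  δ u x = 𝟙 (does (_≟ᵛ_ K x u))

  δ-refl : ∀ u → δ u u ≡ 1
  δ-refl u = cong 𝟙 (dec-true (_≟ᵛ_ K u u) refl)

  δ-≢ : ∀ {u x} → x ≢ u → δ u x ≡ 0
  δ-≢ {u} {x} x≢u = cong 𝟙 (dec-false (_≟ᵛ_ K x u) x≢u)

  Σᵥ-δ : ∀ u (f : V → ℕ) → Σᵥ K (λ x → δ u x * f x) ≡ f u
  Σᵥ-δ u f = begin
    sum (λ i → δ u (from i) * f (from i))
      ≡⟨ sum-single (index K u) (λ j j≢ → cong (_* f (from j))
           (δ-≢ (λ eq → j≢ (trans (sym (index-from j)) (cong (index K) eq))))) ⟩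
    δ u (from (index K u)) * f (from (index K u))
      ≡⟨ cong (λ x → δ u x * f x) (from-index u) ⟩
    δ u u * f u
      ≡⟨ cong (_* f u) (δ-refl u) ⟩
    f u + 0
      ≡⟨ +-identityʳ _ ⟩
    f u ∎
    where open ≡-Reasoning

  e : V → V → ℕ
  e x y = 𝟙 (does (adj? K x y))

  e-adj : ∀ {x y} → Adj K x y → e x y ≡ 1
  e-adj {x} {y} p = cong 𝟙 (dec-true (adj? K x y) p)

  e-¬adj : ∀ {x y} → ¬ Adj K x y → e x y ≡ 0
  e-¬adj {x} {y} p = cong 𝟙 (dec-false (adj? K x y) p)

  e-sym : ∀ x y → e x y ≡ e y x
  e-sym x y with adj? K x y
  ... | yes p = sym (e-adj (adj-sym K p))
  ... | no ¬p = sym (e-¬adj (¬p ∘ adj-sym K))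

  degree-Σᵥ : ∀ u → degree K u ≡ Σᵥ K (e u)
  degree-Σᵥ u = trans (cong (length ∘ filter (adj? K u)) vertices-tabulate)
                      (length-filter-tabulate (adj? K u) from)

  -- Sums over ordered pairs meet each edge twice, hence the factor 2 in all later counts. Without
  -- loops the two orders of an edge differ, and exactly one of them passes the index test of `∣_∣`.
  2*∣∣ : Simple K → (F : EdgeSet K) → 2 * ∣ F ∣ ≡ Σ² K (λ x y → 𝟙 (does (mem? F x y)))
  2*∣∣ simple F = begin
    2 * ∣ F ∣                              ≡⟨ cong (∣ F ∣ +_) (+-identityʳ _) ⟩
    ∣ F ∣ + ∣ F ∣                          ≡⟨ cong (λ k → k + k) ∣F∣≡ ⟩
    Σ² K f + Σ² K f                        ≡⟨ cong (Σ² K f +_) (Σ²-comm f) ⟩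
    Σ² K f + Σ² K (λ x y → f y x)          ≡⟨ Σ²-+ f (λ x y → f y x) ⟨
    Σ² K (λ x y → f x y + f y x)           ≡⟨ Σ²-cong both ⟩
    Σ² K (λ x y → 𝟙 (does (mem? F x y)))   ∎
    where
    open ≡-Reasoning
    P? : Decidable λ (p : V × V) → (index K (proj₁ p) Fin.≤ index K (proj₂ p)) × Mem F (proj₁ p) (proj₂ p)
    P? (x , y) = (index K x Fin.≤? index K y) ×-dec mem? F x y
    f : V → V → ℕ
    f x y = 𝟙 (does (P? (x , y)))
    ∣F∣≡ : ∣ F ∣ ≡ Σ² K f
    ∣F∣≡ = trans (cong (λ vs → length (filter P? (cartesianProduct vs vs))) vertices-tabulate)
                 (length-filter-product P? from from)
    _≤ᵇ_ : V → V → Bool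
    x ≤ᵇ y = does (index K x Fin.≤? index K y)
    both : ∀ x y → f x y + f y x ≡ 𝟙 (does (mem? F x y))
    both x y with mem? F x y | mem? F y x
    ... | yes p | no ¬q = contradiction (mem-sym F p) ¬q
    ... | no ¬p | yes q = contradiction (mem-sym F q) ¬p
    ... | no _  | no _  = cong₂ _+_ (cong 𝟙 (Bool.∧-zeroʳ (x ≤ᵇ y))) (cong 𝟙 (Bool.∧-zeroʳ (y ≤ᵇ x)))
    ... | yes p | yes _ = trans (cong₂ _+_ (cong 𝟙 (Bool.∧-identityʳ (x ≤ᵇ y))) (cong 𝟙 (Bool.∧-identityʳ (y ≤ᵇ x))))
      (≤?-once (λ eq → simple (subst (Adj K x) (sym (index-injective eq)) (mem⇒adj F p))))

-- Arithmetic of the bichromatic edges between two fibres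

-- Read a, b and c, d as the colour counts of two adjacent fibres: every vertex of the second fibre
-- sees at least one vertex of the opposite colour in the first.
split-bound : ∀ {a b} c d → 0 < a → 0 < b → c + d ≤ a * d + b * c
split-bound {suc a} {suc b} c d _ _ =
  subst (c + d ≤_) (eq a b c d) (m≤m+n (c + d) (a * d + b * c))
  where
  eq : ∀ a b c d → (c + d) + (a * d + b * c) ≡ suc a * d + suc b * c
  eq = solve-∀

-- The right side exceeds the left by (b - 1) · c, and b - 1 is positive.
split-bound-tight : ∀ {b} c d → 1 < b → c + d ≡ 1 * d + b * c → c ≡ 0
split-bound-tight {suc (suc b)} c d _ eq =
  m+n≡0⇒m≡0 c (sym (+-cancelˡ-≡ (c + d) 0 (c + b * c) (trans (+-identityʳ (c + d)) (trans eq (expand b c d)))))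
  where
  expand : ∀ b c d → 1 * d + suc (suc b) * c ≡ (c + d) + (c + b * c)
  expand = solve-∀
split-bound-tight {suc zero} c d (s≤s ()) eq

-- Written with successors so that the surplus of `pair-bound`, the last two products, appears
-- without subtraction.
pair-expand : ∀ a b c d → suc a * suc d + suc b * suc c + 2 ≡
              ((suc a + suc b) + (suc c + suc d)) + (a * d + b * c)
pair-expand = solve-∀

pair-bound : ∀ {a b c d} → 0 < a → 0 < b → 0 < c → 0 < d →
             (a + b) + (c + d) ≤ a * d + b * c + 2
pair-bound {suc a} {suc b} {suc c} {suc d} _ _ _ _ =
  ≤-trans (m≤m+n _ (a * d + b * c)) (≤-reflexive (sym (pair-expand a b c d)))

-- The surplus (a - 1)(d - 1) + (b - 1)(c - 1) has to vanish. Of the four ways to kill both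
-- products, a = b = 1 and c = d = 1 would leave a fibre with only two vertices.
pair-bound-tight : ∀ {a b c d} → 0 < a → 0 < b → 0 < c → 0 < d →
                   3 ≤ a + b → 3 ≤ c + d →
                   (a + b) + (c + d) ≡ a * d + b * c + 2 →
                   (a ≡ 1 × c ≡ 1) ⊎ (b ≡ 1 × d ≡ 1)
pair-bound-tight {suc a} {suc b} {suc c} {suc d} _ _ _ _ a+b≥3 c+d≥3 eq
  with m*n≡0⇒m≡0∨n≡0 a (m+n≡0⇒m≡0 (a * d) excess≡0)
     | m*n≡0⇒m≡0∨n≡0 b (m+n≡0⇒n≡0 (a * d) excess≡0)
  where
  excess≡0 : a * d + b * c ≡ 0
  excess≡0 = sym (+-cancelˡ-≡ ((suc a + suc b) + (suc c + suc d)) 0 (a * d + b * c)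
    (trans (+-identityʳ _) (trans eq (pair-expand a b c d))))
... | inj₁ refl | inj₁ refl = contradiction a+b≥3 λ { (s≤s (s≤s ())) }
... | inj₁ refl | inj₂ refl = inj₁ (refl , refl)
... | inj₂ refl | inj₁ refl = inj₂ (refl , refl)
... | inj₂ refl | inj₂ refl = contradiction c+d≥3 λ { (s≤s (s≤s ())) }

-- Counting the edges at the two ends of an edge

module _ (G : Graph) where

  private
    V = Vertex G

  adj⇒≢ : Simple G → ∀ {x y} → Adj G x y → x ≢ y
  adj⇒≢ simple adj refl = simple adj

  -- The indicator of {u , v} for distinct u and v, written so that sums weighted by it collapse to
  -- two values.
  s : V → V → V → ℕ
  s u v x = δ G u x + δ G v x

  data s-View (u v x : V) : Set where
    is-u : x ≡ u → x ≢ v → s u v x ≡ 1 → s-View u v x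
    is-v : x ≡ v → x ≢ u → s u v x ≡ 1 → s-View u v x
    else : x ≢ u → x ≢ v → s u v x ≡ 0 → s-View u v x

  s-view : ∀ {u v} → u ≢ v → ∀ x → s-View u v x
  s-view {u} {v} u≢v x = helper (_≟ᵛ_ G x u) (_≟ᵛ_ G x v)
    where
    helper : Dec (x ≡ u) → Dec (x ≡ v) → s-View u v x
    helper (yes refl) (yes refl) = contradiction refl u≢v
    helper (yes refl) (no x≢v)   = is-u refl x≢v (cong₂ _+_ (δ-refl G u) (δ-≢ G x≢v))
    helper (no x≢u)   (yes refl) = is-v refl x≢u (cong₂ _+_ (δ-≢ G x≢u) (δ-refl G v))
    helper (no x≢u)   (no x≢v)   = else x≢u x≢v (cong₂ _+_ (δ-≢ G x≢u) (δ-≢ G x≢v))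

  Σᵥ-s : ∀ u v (f : V → ℕ) → Σᵥ G (λ x → s u v x * f x) ≡ f u + f v
  Σᵥ-s u v f = begin
    Σᵥ G (λ x → s u v x * f x)
      ≡⟨ Σᵥ-cong G (λ x → *-distribʳ-+ (f x) (δ G u x) (δ G v x)) ⟩
    Σᵥ G (λ x → δ G u x * f x + δ G v x * f x)
      ≡⟨ Σᵥ-+ G (λ x → δ G u x * f x) (λ x → δ G v x * f x) ⟩
    Σᵥ G (λ x → δ G u x * f x) + Σᵥ G (λ x → δ G v x * f x)
      ≡⟨ cong₂ _+_ (Σᵥ-δ G u f) (Σᵥ-δ G v f) ⟩
    f u + f v ∎
    where open ≡-Reasoning

  -- The number of ends of the edge xy inside {u , v}. Times n, it is the number of cut edges that
  -- the lower bounds charge to xy, up to corrections such as `inner`.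
  ends : V → V → V → V → ℕ
  ends u v x y = e G x y * (s u v x + s u v y)

  inner : V → V → V → V → ℕ
  inner u v x y = e G x y * (s u v x * s u v y)

  -- Reversing the pairs in the second half makes both halves count the edges leaving u and v.
  Σ²-ends : ∀ u v → Σ² G (ends u v) ≡ 2 * (degree G u + degree G v)
  Σ²-ends u v = begin
    Σ² G (ends u v)
      ≡⟨ Σ²-cong G (λ x y → *-distribˡ-+ (e G x y) (s u v x) (s u v y)) ⟩
    Σ² G (λ x y → e G x y * s u v x + e G x y * s u v y)
      ≡⟨ Σ²-+ G (λ x y → e G x y * s u v x) (λ x y → e G x y * s u v y) ⟩
    Σ² G (λ x y → e G x y * s u v x) + Σ² G (λ x y → e G x y * s u v y)
      ≡⟨ cong (Σ² G (λ x y → e G x y * s u v x) +_)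
           (trans (Σ²-comm G (λ x y → e G x y * s u v y))
                  (Σ²-cong G (λ x y → cong (_* s u v x) (e-sym G y x)))) ⟩
    Σ² G (λ x y → e G x y * s u v x) + Σ² G (λ x y → e G x y * s u v x)
      ≡⟨ cong (λ k → k + k) half ⟩
    (degree G u + degree G v) + (degree G u + degree G v)
      ≡⟨ cong ((degree G u + degree G v) +_) (+-identityʳ _) ⟨
    2 * (degree G u + degree G v) ∎
    where
    open ≡-Reasoning
    half : Σ² G (λ x y → e G x y * s u v x) ≡ degree G u + degree G v
    half = begin
      Σ² G (λ x y → e G x y * s u v x)
        ≡⟨ Σ²-cong G (λ x y → *-comm (e G x y) (s u v x)) ⟩
      Σ² G (λ x y → s u v x * e G x y)
        ≡⟨ Σᵥ-cong G (λ x → Σᵥ-* G (s u v x) (e G x)) ⟩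
      Σᵥ G (λ x → s u v x * Σᵥ G (e G x))
        ≡⟨ Σᵥ-s u v (λ x → Σᵥ G (e G x)) ⟩
      Σᵥ G (e G u) + Σᵥ G (e G v)
        ≡⟨ cong₂ _+_ (degree-Σᵥ G u) (degree-Σᵥ G v) ⟨
      degree G u + degree G v ∎

  -- Only the pairs (u , v) and (v , u) survive, since u and v carry no loops.
  Σ²-inner : Simple G → ∀ {u v} → Adj G u v → Σ² G (inner u v) ≡ 2
  Σ²-inner simple {u} {v} adj = begin
    Σ² G (inner u v)
      ≡⟨ Σ²-cong G (λ x y → rearrange (e G x y) (s u v x) (s u v y)) ⟩
    Σ² G (λ x y → s u v x * (s u v y * e G x y))
      ≡⟨ Σᵥ-cong G (λ x → Σᵥ-* G (s u v x) (λ y → s u v y * e G x y)) ⟩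
    Σᵥ G (λ x → s u v x * Σᵥ G (λ y → s u v y * e G x y))
      ≡⟨ Σᵥ-s u v (λ x → Σᵥ G (λ y → s u v y * e G x y)) ⟩
    Σᵥ G (λ y → s u v y * e G u y) + Σᵥ G (λ y → s u v y * e G v y)
      ≡⟨ cong₂ _+_ (Σᵥ-s u v (e G u)) (Σᵥ-s u v (e G v)) ⟩
    (e G u u + e G u v) + (e G v u + e G v v)
      ≡⟨ cong₂ _+_ (cong₂ _+_ (e-¬adj G simple) (e-adj G adj))
                   (cong₂ _+_ (e-adj G (adj-sym G adj)) (e-¬adj G simple)) ⟩
    2 ∎
    where
    open ≡-Reasoning
    rearrange : ∀ e x y → e * (x * y) ≡ x * (y * e)
    rearrange = solve-∀

  -- A set of vertices of G × T_n meeting the fibre of x in a x vertices and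
  -- missing b x of them has a boundary with cut a b x y edges between the
  -- fibres of adjacent x and y.
  cut : (V → ℕ) → (V → ℕ) → V → V → ℕ
  cut a b x y = a x * b y + b x * a y

  cut-sym : ∀ a b x y → cut a b x y ≡ cut a b y x
  cut-sym a b x y = rearrange (a x) (b x) (a y) (b y)
    where
    rearrange : ∀ p q r t → p * t + q * r ≡ r * q + t * p
    rearrange = solve-∀

  -- Colour profiles and split edges

  module Profile (simple : Simple G) (n : ℕ) (n≥3 : 3 ≤ n) (a b : V → ℕ) (a+b≡n : ∀ x → a x + b x ≡ n) where

    Split : V → Set
    Split x = 0 < a x × 0 < b x

    -- Twice the number of bichromatic edges, as each edge of `G` enters in both orders.
    S : ℕ
    S = Σ² G (λ x y → e G x y * cut a b x y)

    cut≥n : ∀ {x} y → Split x → n ≤ cut a b x y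
    cut≥n y (ax>0 , bx>0) =
      subst (_≤ cut a b _ y) (a+b≡n y) (split-bound (a y) (b y) ax>0 bx>0)

    -- Pairs inside {u , v} are hit twice on the left, and the correction term
    -- restores the deficit 2n − cut ≤ 2.
    ends≤cut : ∀ {u v} → Adj G u v → Split u → Split v → ∀ x y →
               n * ends u v x y ≤ e G x y * cut a b x y + 2 * inner u v x y
    ends≤cut {u} {v} adj u-split v-split x y = by-adj (adj? G x y)
      where
      split : ∀ {z} → z ≡ u ⊎ z ≡ v → Split z
      split (inj₁ refl) = u-split
      split (inj₂ refl) = v-split
      Bound : ℕ → ℕ → ℕ → Set
      Bound e sx sy = n * (e * (sx + sy)) ≤ e * cut a b x y + 2 * (e * (sx * sy))
      both : Split x → Split y → Bound 1 1 1
      both (ax>0 , bx>0) (ay>0 , by>0) = begin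
        n * 2                        ≡⟨ *-comm n 2 ⟩
        n + (n + 0)                  ≡⟨ cong (n +_) (+-identityʳ n) ⟩
        n + n                        ≡⟨ cong₂ _+_ (a+b≡n x) (a+b≡n y) ⟨
        (a x + b x) + (a y + b y)    ≤⟨ pair-bound ax>0 bx>0 ay>0 by>0 ⟩
        cut a b x y + 2              ≡⟨ cong (_+ 2) (+-identityʳ (cut a b x y)) ⟨
        1 * cut a b x y + 2          ∎
        where open ≤-Reasoning
      one : n ≤ cut a b x y → n * 1 ≤ 1 * cut a b x y + 0
      one n≤cut = begin
        n * 1                ≡⟨ *-identityʳ n ⟩
        n                    ≤⟨ n≤cut ⟩
        cut a b x y          ≡⟨ trans (+-identityʳ _) (+-identityʳ _) ⟨
        1 * cut a b x y + 0  ∎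
        where open ≤-Reasoning
      data End (z : V) : Set where
        inside  : Split z → s u v z ≡ 1 → End z
        outside : s u v z ≡ 0 → End z
      end : ∀ z → End z
      end z with s-view (adj⇒≢ simple adj) z
      ... | is-u z≡u _ eq = inside (split (inj₁ z≡u)) eq
      ... | is-v z≡v _ eq = inside (split (inj₂ z≡v)) eq
      ... | else _ _ eq   = outside eq
      by-end : End x → End y → Bound 1 (s u v x) (s u v y)
      by-end (inside x-split sx) (inside y-split sy) =
        subst₂ (Bound 1) (sym sx) (sym sy) (both x-split y-split)
      by-end (inside x-split sx) (outside sy) =
        subst₂ (Bound 1) (sym sx) (sym sy) (one (cut≥n y x-split))
      by-end (outside sx) (inside y-split sy) =
        subst₂ (Bound 1) (sym sx) (sym sy) (one (subst (n ≤_) (cut-sym a b y x) (cut≥n x y-split)))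
      by-end (outside sx) (outside sy) =
        subst₂ (Bound 1) (sym sx) (sym sy) (subst (_≤ 1 * cut a b x y + 0) (sym (*-zeroʳ n)) z≤n)
      by-adj : Dec (Adj G x y) → Bound (e G x y) (s u v x) (s u v y)
      by-adj (yes p) = subst (λ k → Bound k (s u v x) (s u v y)) (sym (e-adj G p)) (by-end (end x) (end y))
      by-adj (no ¬p) = subst (λ k → Bound k (s u v x) (s u v y)) (sym (e-¬adj G ¬p))
                             (subst (_≤ 0) (sym (*-zeroʳ n)) z≤n)

    -- The profile of a two-element set with one vertex over u and one over v.
    Pair : V → V → Set
    Pair u v = a u ≡ 1 × a v ≡ 1 × (∀ x → x ≢ u → x ≢ v → a x ≡ 0)

    b>1 : ∀ {x} → a x ≡ 1 → 1 < b x
    b>1 {x} ax≡1 = +-cancelˡ-≤ 1 2 (b x) (≤-trans n≥3 (≤-reflexive (trans (sym (a+b≡n x)) (cong (_+ b x) ax≡1))))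

    -- Walk away from u. A step out of {u , v} cannot reach a fibre with a > 0, which would create a
    -- surplus. Beyond {u , v}, tightness means no cut edges at all, so a = 0 passes from fibre to
    -- fibre, and connectedness carries it everywhere.
    tight⇒Pair : Connected G → ∀ {u v} → Adj G u v → a u ≡ 1 → a v ≡ 1 →
      (∀ x y → n * ends u v x y ≡ e G x y * cut a b x y + 2 * inner u v x y) → Pair u v
    tight⇒Pair conn {u} {v} adj au≡1 av≡1 tight =
      -- The walk can start at u because `Rest u` holds vacuously.
      au≡1 , av≡1 , λ x → spread (conn u x) λ u≢u → contradiction refl u≢u
      where
      Rest : V → Set
      Rest x = x ≢ u → x ≢ v → a x ≡ 0
      tight-adj : ∀ {x y} → Adj G x y → ∀ {p q} → s u v x ≡ p → s u v y ≡ q →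
        n * (1 * (p + q)) ≡ 1 * cut a b x y + 2 * (1 * (p * q))
      tight-adj {x} {y} xy refl refl =
        subst (λ k → n * (k * (s u v x + s u v y)) ≡ k * cut a b x y + 2 * (k * (s u v x * s u v y)))
              (e-adj G xy) (tight x y)
      -- As n ≥ 3, the fibre of x has one vertex of the first colour against at least two of the
      -- other, so the surplus (b x - 1) · a y vanishes only for a y = 0.
      from-end : ∀ {x y} → Adj G x y → a x ≡ 1 → s u v x ≡ 1 → s u v y ≡ 0 → a y ≡ 0
      from-end {x} {y} xy ax≡1 sx sy = split-bound-tight (a y) (b y) (b>1 ax≡1) (begin
        a y + b y                  ≡⟨ a+b≡n y ⟩
        n                          ≡⟨ *-identityʳ n ⟨
        n * 1                      ≡⟨ tight-adj xy sx sy ⟩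
        1 * cut a b x y + 0        ≡⟨ trans (+-identityʳ _) (+-identityʳ _) ⟩
        a x * b y + b x * a y      ≡⟨ cong (λ k → k * b y + b x * a y) ax≡1 ⟩
        1 * b y + b x * a y        ∎)
        where open ≡-Reasoning
      from-else : ∀ {x y} → Adj G x y → a x ≡ 0 → s u v x ≡ 0 → s u v y ≡ 0 → a y ≡ 0
      from-else {x} {y} xy ax≡0 sx sy with m*n≡0⇒m≡0∨n≡0 (b x) bx*ay≡0
        where
        bx*ay≡0 : b x * a y ≡ 0
        bx*ay≡0 = m+n≡0⇒n≡0 (a x * b y) (trans (sym (trans (+-identityʳ _) (+-identityʳ _)))
                    (trans (sym (tight-adj xy sx sy)) (*-zeroʳ n)))
      ... | inj₂ ay≡0 = ay≡0
      ... | inj₁ bx≡0 = contradiction n≥3 (subst (λ k → ¬ 3 ≤ k) (trans (sym (cong₂ _+_ ax≡0 bx≡0)) (a+b≡n x)) λ ())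
      step : ∀ {x y} → Adj G x y → Rest x → Rest y
      step {x} {y} xy ax≡0 y≢u y≢v with s-view (adj⇒≢ simple adj) x | s-view (adj⇒≢ simple adj) y
      ... | _                  | is-u y≡u _ _ = contradiction y≡u y≢u
      ... | _                  | is-v y≡v _ _ = contradiction y≡v y≢v
      ... | is-u refl _ sx     | else _ _ sy  = from-end xy au≡1 sx sy
      ... | is-v refl _ sx     | else _ _ sy  = from-end xy av≡1 sx sy
      ... | else x≢u x≢v sx    | else _ _ sy  = from-else xy (ax≡0 x≢u x≢v) sx sy
      spread : ∀ {x y} → Reachable G x y → Rest x → Rest y
      spread ε        rest = rest
      spread (xy ◅ p) rest = spread p (step xy rest)

  module SplitEdge (simple : Simple G) (n : ℕ) (n≥3 : 3 ≤ n) (a b : V → ℕ) (a+b≡n : ∀ x → a x + b x ≡ n) where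

    private
      module A = Profile simple n n≥3 a b a+b≡n
      module B = Profile simple n n≥3 b a (λ x → trans (+-comm (b x) (a x)) (a+b≡n x))

    -- The last assumption reverses the sum of `A.ends≤cut` over all pairs, so equality holds pair
    -- by pair. At uv it decides which colour is single in both fibres; at the other pairs it
    -- empties the remaining fibres of that colour. `B` is `A` with the colours exchanged.
    splitEdge⇒Pair : Connected G → ∀ {u v} → Adj G u v → A.Split u → A.Split v →
      A.S + 4 ≤ n * (2 * (degree G u + degree G v)) → A.Pair u v ⊎ B.Pair u v
    splitEdge⇒Pair conn {u} {v} adj (au>0 , bu>0) (av>0 , bv>0) S+4≤ =
      conclude (pair-bound-tight au>0 bu>0 av>0 bv>0 (≥3 u) (≥3 v) uv-tight)
      where
      open ≡-Reasoning
      ≥3 : ∀ x → 3 ≤ a x + b x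
      ≥3 x = subst (3 ≤_) (sym (a+b≡n x)) n≥3
      -- The 4 is the weight 2 times the total 2 of `inner`.
      S+4≡ : Σ² G (λ x y → e G x y * cut a b x y + 2 * inner u v x y) ≡ A.S + 4
      S+4≡ = trans (Σ²-+ G (λ x y → e G x y * cut a b x y) (λ x y → 2 * inner u v x y))
                (cong (A.S +_) (trans (Σ²-* G 2 (inner u v)) (cong (2 *_) (Σ²-inner simple adj))))
      tight : ∀ x y → n * ends u v x y ≡ e G x y * cut a b x y + 2 * inner u v x y
      tight = Σ²-mono-≡ G (A.ends≤cut adj (au>0 , bu>0) (av>0 , bv>0))
        (subst₂ _≤_ (sym S+4≡) (sym (trans (Σ²-* G n (ends u v)) (cong (n *_) (Σ²-ends u v)))) S+4≤)
      s-at : ∀ {x y} → x ≢ y → s x y x ≡ 1 × s x y y ≡ 1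
      s-at x≢y = cong₂ _+_ (δ-refl G _) (δ-≢ G x≢y) , cong₂ _+_ (δ-≢ G (x≢y ∘ sym)) (δ-refl G _)
      uv-tight : (a u + b u) + (a v + b v) ≡ cut a b u v + 2
      uv-tight = begin
        (a u + b u) + (a v + b v) ≡⟨ cong₂ _+_ (a+b≡n u) (a+b≡n v) ⟩
        n + n                     ≡⟨ cong (n +_) (+-identityʳ n) ⟨
        2 * n                     ≡⟨ *-comm 2 n ⟩
        n * (1 * (1 + 1))
          ≡⟨ cong₂ (λ i j → n * (1 * (i + j))) (proj₁ (s-at (adj⇒≢ simple adj)))
                                                                 (proj₂ (s-at (adj⇒≢ simple adj))) ⟨
        n * (1 * (s u v u + s u v v))
          ≡⟨ subst (λ k → n * (k * (s u v u + s u v v)) ≡ k * cut a b u v + 2 * (k * (s u v u * s u v v)))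
                   (e-adj G adj) (tight u v) ⟩
        1 * cut a b u v + 2 * (1 * (s u v u * s u v v))
          ≡⟨ cong₂ (λ i j → 1 * cut a b u v + 2 * (1 * (i * j))) (proj₁ (s-at (adj⇒≢ simple adj)))
                                                                 (proj₂ (s-at (adj⇒≢ simple adj))) ⟩
        1 * cut a b u v + 2       ≡⟨ cong (_+ 2) (+-identityʳ _) ⟩
        cut a b u v + 2           ∎
      conclude : (a u ≡ 1 × a v ≡ 1) ⊎ (b u ≡ 1 × b v ≡ 1) → A.Pair u v ⊎ B.Pair u v
      conclude (inj₁ (au≡1 , av≡1)) = inj₁ (A.tight⇒Pair conn adj au≡1 av≡1 tight)
      conclude (inj₂ (bu≡1 , bv≡1)) = inj₂ (B.tight⇒Pair conn adj bu≡1 bv≡1 λ x y →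
        trans (tight x y) (cong (λ k → e G x y * k + 2 * inner u v x y) (+-comm (a x * b y) (b x * a y))))

-- Monochromatic fibres and their neighbours

module _ (G : Graph) where
  private
    V = Vertex G

  -- Marks the edge wy in both orders; the correction for its extra cut edges is attached to it.
  δ² : V → V → V → V → ℕ
  δ² w y p q = δ G w p * δ G y q + δ G y p * δ G w q

  δ²-sym : ∀ w y p q → δ² w y p q ≡ δ² w y q p
  δ²-sym w y p q = rearrange (δ G w p) (δ G y q) (δ G y p) (δ G w q)
    where
    rearrange : ∀ i j k l → i * j + k * l ≡ l * k + j * i
    rearrange = solve-∀

  δδ≡0 : ∀ {w y p q} → ¬ (p ≡ w × q ≡ y) → δ G w p * δ G y q ≡ 0
  δδ≡0 {w} {y} {p} {q} ¬eq with _≟ᵛ_ G p w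
  ... | no p≢w  = cong (_* δ G y q) (δ-≢ G p≢w)
  ... | yes p≡w = trans (cong (δ G w p *_) (δ-≢ G (λ q≡y → ¬eq (p≡w , q≡y)))) (*-zeroʳ (δ G w p))

  δ²≡0 : ∀ {w y p q} → ¬ (p ≡ w × q ≡ y) → ¬ (p ≡ y × q ≡ w) → δ² w y p q ≡ 0
  δ²≡0 ¬wy ¬yw = cong₂ _+_ (δδ≡0 ¬wy) (δδ≡0 ¬yw)

  Σ²-δδ : ∀ w y → Σ² G (λ p q → δ G w p * δ G y q) ≡ 1
  Σ²-δδ w y = begin
    Σ² G (λ p q → δ G w p * δ G y q)
      ≡⟨ Σᵥ-cong G (λ p → Σᵥ-* G (δ G w p) (δ G y)) ⟩
    Σᵥ G (λ p → δ G w p * Σᵥ G (δ G y))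
      ≡⟨ Σᵥ-δ G w (λ _ → Σᵥ G (δ G y)) ⟩
    Σᵥ G (δ G y)
      ≡⟨ Σᵥ-cong G (λ q → *-identityʳ (δ G y q)) ⟨
    Σᵥ G (λ q → δ G y q * 1)
      ≡⟨ Σᵥ-δ G y (λ _ → 1) ⟩
    1 ∎
    where open ≡-Reasoning

  Σ²-δ² : ∀ w y → Σ² G (δ² w y) ≡ 2
  Σ²-δ² w y = trans (Σ²-+ G (λ p q → δ G w p * δ G y q) (λ p q → δ G y p * δ G w q))
                    (cong₂ _+_ (Σ²-δδ w y) (Σ²-δδ y w))

  module Full (simple : Simple G) (n : ℕ) (n≥3 : 3 ≤ n) (a b : V → ℕ) (a+b≡n : ∀ x → a x + b x ≡ n) where

    open Profile G simple n n≥3 a b a+b≡n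

    private
      a≡n : ∀ {x} → b x ≡ 0 → a x ≡ n
      a≡n {x} bx≡0 = trans (sym (+-identityʳ (a x))) (trans (cong (a x +_) (sym bx≡0)) (a+b≡n x))

      b≡n : ∀ {x} → a x ≡ 0 → b x ≡ n
      b≡n {x} ax≡0 = trans (cong (_+ b x) (sym ax≡0)) (a+b≡n x)

      cut-full : ∀ {x} y → b x ≡ 0 → cut G a b x y ≡ n * b y
      cut-full {x} y bx≡0 = trans (cong₂ (λ i j → i * b y + j * a y) (a≡n bx≡0) bx≡0) (+-identityʳ _)

      cut-empty : ∀ {y} x → a y ≡ 0 → cut G a b x y ≡ a x * n
      cut-empty {y} x ay≡0 = trans (cong₂ (λ i j → a x * i + b x * j) (b≡n ay≡0) ay≡0)
        (trans (cong (a x * n +_) (*-zeroʳ (b x))) (+-identityʳ _))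

    -- The edge xw may have as few as n cut edges, but then a w = n − 1 and
    -- the edge wy has n (n − 1) of them, which makes up for it.
    module FullSplitEmpty {x w y : V} (xw : Adj G x w) (wy : Adj G w y)
      (bx≡0 : b x ≡ 0) (w-split : Split w) (ay≡0 : a y ≡ 0)
      (b-nbrs : ∀ {z} → Adj G x z → 0 < b z) where

      private
        -- Each end in {x , w} charges n. The edge xw has n · b w cut edges against a charge of 2n,
        -- and wy has n · a w against n. The terms with sp * sq and with t book these differences,
        -- split over both sides to avoid subtraction. Here e marks an edge, c is its cut, and t
        -- marks wy.
        Bound′ : ℕ → ℕ → ℕ → ℕ → ℕ → Set
        Bound′ e c sp sq t =
          (n * (e * (sp + sq)) + (n * a w) * t) + (n * b w) * (e * (sp * sq)) ≤
          (e * c + n * t) + (2 * n) * (e * (sp * sq))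

        Bound : V → V → Set
        Bound p q = Bound′ (e G p q) (cut G a b p q) (s G x w p) (s G x w q) (δ² w y p q)

        swap : ∀ {e e′ c c′ t t′} sp sq → e ≡ e′ → c ≡ c′ → t ≡ t′ →
               Bound′ e c sp sq t → Bound′ e′ c′ sq sp t′
        swap {e} {c = c} {t = t} sp sq refl refl refl =
          subst₂ (λ i j → (n * (e * i) + (n * a w) * t) + (n * b w) * (e * j) ≤
                          (e * c + n * t) + (2 * n) * (e * j))
                 (+-comm sp sq) (*-comm sp sq)

        Bound-sym : ∀ p q → Bound p q → Bound q p
        Bound-sym p q = swap (s G x w p) (s G x w q)
          (e-sym G p q) (cut-sym G a b p q) (δ²-sym w y p q)

        edge-bound : ∀ {p q sp sq t} → Adj G p q → s G x w p ≡ sp → s G x w q ≡ sq →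
          δ² w y p q ≡ t → Bound′ 1 (cut G a b p q) sp sq t → Bound p q
        edge-bound {p} {q} pq refl refl refl =
          subst (λ k → Bound′ k (cut G a b p q) (s G x w p) (s G x w q) (δ² w y p q))
                (sym (e-adj G pq))

        zero-bound : ∀ {p q} → e G p q ≡ 0 ⊎ (s G x w p ≡ 0 × s G x w q ≡ 0) →
                     δ² w y p q ≡ 0 → Bound p q
        zero-bound {p} {q} e≡0⊎s≡0 t≡0 = ≤-trans (≤-reflexive
          (trans (cong₂ (λ i j → (n * i + (n * a w) * j) + (n * b w) * inner G x w p q) (ends≡0 e≡0⊎s≡0) t≡0)
          (trans (cong (λ i → (n * 0 + (n * a w) * 0) + (n * b w) * i) (inner≡0 e≡0⊎s≡0))
                 (zeros n (a w) (b w))))) z≤n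
          where
          zeros : ∀ n i j → (n * 0 + (n * i) * 0) + (n * j) * 0 ≡ 0
          zeros = solve-∀
          ends≡0 : e G p q ≡ 0 ⊎ (s G x w p ≡ 0 × s G x w q ≡ 0) → ends G x w p q ≡ 0
          ends≡0 (inj₁ e≡0) = cong (_* (s G x w p + s G x w q)) e≡0
          ends≡0 (inj₂ (sp , sq)) = trans (cong (e G p q *_) (cong₂ _+_ sp sq)) (*-zeroʳ (e G p q))
          inner≡0 : e G p q ≡ 0 ⊎ (s G x w p ≡ 0 × s G x w q ≡ 0) → inner G x w p q ≡ 0
          inner≡0 (inj₁ e≡0) = cong (_* (s G x w p * s G x w q)) e≡0
          inner≡0 (inj₂ (sp , sq)) = trans (cong (e G p q *_) (cong₂ _*_ sp sq)) (*-zeroʳ (e G p q))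

        ordinary : ∀ {c} → n ≤ c → Bound′ 1 c 1 0 0
        ordinary {c} n≤c = subst₂ _≤_ (sym (left n (a w) (b w))) (sym (right n c)) n≤c
          where
          left : ∀ n i j → (n * (1 * (1 + 0)) + (n * i) * 0) + (n * j) * (1 * (1 * 0)) ≡ n
          left = solve-∀
          right : ∀ n c → (1 * c + n * 0) + (2 * n) * (1 * (1 * 0)) ≡ c
          right = solve-∀

        full-split : ∀ {c} → c ≡ n * b w → Bound′ 1 c 1 1 0
        full-split refl = ≤-reflexive (eq n (a w) (b w))
          where
          eq : ∀ n i j → (n * (1 * (1 + 1)) + (n * i) * 0) + (n * j) * (1 * (1 * 1)) ≡
                         (1 * (n * j) + n * 0) + (2 * n) * (1 * (1 * 1))
          eq = solve-∀

        split-empty : ∀ {c} → c ≡ a w * n → Bound′ 1 c 1 0 1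
        split-empty refl = ≤-reflexive (eq n (a w) (b w))
          where
          eq : ∀ n i j → (n * (1 * (1 + 0)) + (n * i) * 1) + (n * j) * (1 * (1 * 0)) ≡
                         (1 * (i * n) + n * 1) + (2 * n) * (1 * (1 * 0))
          eq = solve-∀

        w≢x : w ≢ x
        w≢x refl = simple xw

        y≢x : y ≢ x
        y≢x refl = contradiction (trans (sym (a≡n bx≡0)) ay≡0) (m<n⇒n≢0 n≥3)

        y≢w : y ≢ w
        y≢w refl = simple wy

        from-x : ∀ q → Adj G x q → Bound x q
        from-x q xq with s-view G (w≢x ∘ sym) q
        ... | is-u refl _ _   = contradiction xq simple
        ... | is-v refl _ sq  = edge-bound xq sx sq (δ²≡0 (λ (x≡w , _) → w≢x (sym x≡w)) (λ (x≡y , _) → y≢x (sym x≡y)))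
                                  (full-split (cut-full q bx≡0))
          where
          sx : s G x w x ≡ 1
          sx = cong₂ _+_ (δ-refl G x) (δ-≢ G (w≢x ∘ sym))
        -- Over the full fibre of x, a neighbour q with b q > 0 yields n · b q ≥ n cut edges.
        ... | else _ q≢w sq   = edge-bound xq sx sq (δ²≡0 (λ (x≡w , _) → w≢x (sym x≡w)) (λ (_ , q≡w) → q≢w q≡w))
                                  (ordinary (≤-trans (m≤m*n n (b q) {{>-nonZero (b-nbrs xq)}}) (≤-reflexive (sym (cut-full q bx≡0)))))
          where
          sx : s G x w x ≡ 1
          sx = cong₂ _+_ (δ-refl G x) (δ-≢ G (w≢x ∘ sym))

        from-w : ∀ q → Adj G w q → Bound w q
        from-w q wq with s-view G (w≢x ∘ sym) q | _≟ᵛ_ G q y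
        ... | is-v refl _ _   | _        = contradiction wq simple
        ... | is-u refl _ _   | _        = Bound-sym q w (from-x w xw)
        ... | else _ _ sq     | yes refl = edge-bound wq sw sq
                (cong₂ _+_ (cong₂ _*_ (δ-refl G w) (δ-refl G y)) (δδ≡0 (λ (w≡y , _) → y≢w (sym w≡y))))
                (split-empty (cut-empty w ay≡0))
          where
          sw : s G x w w ≡ 1
          sw = cong₂ _+_ (δ-≢ G w≢x) (δ-refl G w)
        ... | else _ _ sq     | no q≢y   = edge-bound wq sw sq
                (δ²≡0 (λ (_ , q≡y) → q≢y q≡y) (λ (w≡y , _) → y≢w (sym w≡y)))
                (ordinary (cut≥n q w-split))
          where
          sw : s G x w w ≡ 1
          sw = cong₂ _+_ (δ-≢ G w≢x) (δ-refl G w)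

        bound-adj : ∀ p q → Adj G p q → Bound p q
        bound-adj p q pq with s-view G (w≢x ∘ sym) p | s-view G (w≢x ∘ sym) q
        ... | is-u refl _ _ | _             = from-x q pq
        ... | is-v refl _ _ | _             = from-w q pq
        ... | else _ _ _    | is-u refl _ _ = Bound-sym q p (from-x p (adj-sym G pq))
        ... | else _ _ _    | is-v refl _ _ = Bound-sym q p (from-w p (adj-sym G pq))
        ... | else _ p≢w sp | else _ q≢w sq =
          zero-bound (inj₂ (sp , sq)) (δ²≡0 (λ (p≡w , _) → p≢w p≡w) (λ (_ , q≡w) → q≢w q≡w))

        bound : ∀ p q → Bound p q
        bound p q = by-adj (adj? G p q)
          where
          by-adj : Dec (Adj G p q) → Bound p q
          by-adj (yes pq) = bound-adj p q pq
          by-adj (no ¬pq) = zero-bound (inj₁ (e-¬adj G ¬pq))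
            (δ²≡0 (λ { (refl , refl) → ¬pq wy }) (λ { (refl , refl) → ¬pq (adj-sym G wy) }))

      -- Summed over all pairs, the corrections are 2n · a w + 2n · b w = 2n² on the left and 2n +
      -- 4n = 6n on the right; n ≥ 3 lets them cancel.
      S-bound : n * (2 * (degree G x + degree G w)) ≤ S
      S-bound = +-cancelʳ-≤ (n * 6) _ S (begin
        n * (2 * D) + n * 6
          ≤⟨ +-monoʳ-≤ (n * (2 * D)) (*-monoʳ-≤ n (*-monoˡ-≤ 2 n≥3)) ⟩
        n * (2 * D) + n * (n * 2)
          ≡⟨ cong (λ k → n * (2 * D) + n * (k * 2)) (a+b≡n w) ⟨
        n * (2 * D) + n * ((a w + b w) * 2)
          ≡⟨ left n D (a w) (b w) ⟩
        (n * (2 * D) + (n * a w) * 2) + (n * b w) * 2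
          ≡⟨ cong₂ _+_ (cong₂ _+_ (trans (Σ²-* G n E) (cong (n *_) (Σ²-ends G x w)))
                                  (trans (Σ²-* G (n * a w) T) (cong (n * a w *_) (Σ²-δ² w y))))
                       (trans (Σ²-* G (n * b w) I) (cong (n * b w *_) (Σ²-inner G simple xw))) ⟨
        (Σ² G (λ p q → n * E p q) + Σ² G (λ p q → (n * a w) * T p q)) + Σ² G (λ p q → (n * b w) * I p q)
          ≡⟨ Σ²-+₃ (λ p q → n * E p q) (λ p q → (n * a w) * T p q) (λ p q → (n * b w) * I p q) ⟨
        Σ² G (λ p q → (n * E p q + (n * a w) * T p q) + (n * b w) * I p q)
          ≤⟨ Σ²-mono G bound ⟩
        Σ² G (λ p q → (C p q + n * T p q) + (2 * n) * I p q)
          ≡⟨ Σ²-+₃ C (λ p q → n * T p q) (λ p q → (2 * n) * I p q) ⟩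
        (S + Σ² G (λ p q → n * T p q)) + Σ² G (λ p q → (2 * n) * I p q)
          ≡⟨ cong₂ _+_ (cong (S +_) (trans (Σ²-* G n T) (cong (n *_) (Σ²-δ² w y))))
                       (trans (Σ²-* G (2 * n) I) (cong (2 * n *_) (Σ²-inner G simple xw))) ⟩
        (S + n * 2) + (2 * n) * 2
          ≡⟨ right n S ⟩
        S + n * 6 ∎)
        where
        open ≤-Reasoning
        D = degree G x + degree G w
        E = ends G x w
        T = δ² w y
        I = inner G x w
        C : V → V → ℕ
        C p q = e G p q * cut G a b p q
        Σ²-+₃ : (f g h : V → V → ℕ) → Σ² G (λ p q → (f p q + g p q) + h p q) ≡ (Σ² G f + Σ² G g) + Σ² G h
        Σ²-+₃ f g h = trans (Σ²-+ G (λ p q → f p q + g p q) h) (cong (_+ Σ² G h) (Σ²-+ G f g))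
        left : ∀ n D i j → n * (2 * D) + n * ((i + j) * 2) ≡ (n * (2 * D) + (n * i) * 2) + (n * j) * 2
        left = solve-∀
        right : ∀ n S → (S + n * 2) + (2 * n) * 2 ≡ S + n * 6
        right = solve-∀

    -- Suppose every neighbour of x meets the second colour. A neighbour w that also meets the first
    -- is split and has a neighbour y meeting the second. As no edge is split at both ends, a y = 0,
    -- and `S-bound` for x, w, y contradicts the smallness of `S`.
    full-neighbour :
      (∀ {x y} → Adj G x y → Split x → ¬ Split y) →
      (∀ {x} → 0 < a x → ∃ λ y → Adj G x y × 0 < a y) →
      (∀ {x} → 0 < b x → ∃ λ y → Adj G x y × 0 < b y) →
      (∀ {x y} → Adj G x y → S + 4 ≤ n * (2 * (degree G x + degree G y))) →
      ∀ {x} → b x ≡ 0 → ∃ λ y → Adj G x y × b y ≡ 0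
    full-neighbour no-split-edge a-neighbour b-neighbour S-small {x} bx≡0
      with any-vertex? G (λ y → adj? G x y ×-dec (b y ≟ 0))
    ... | yes (y , xy , by≡0) = y , xy , by≡0
    ... | no ¬full = ⊥-elim contra
      where
      b-nbrs : ∀ {z} → Adj G x z → 0 < b z
      b-nbrs xz = n≢0⇒n>0 (λ bz≡0 → ¬full (_ , xz , bz≡0))
      contra : ⊥
      contra with a-neighbour (subst (0 <_) (sym (a≡n bx≡0)) (≤-trans (s≤s z≤n) n≥3))
      ... | w , xw , aw>0 with b-neighbour (b-nbrs xw)
      ...   | y , wy , by>0 with a y ≟ 0
      ...     | no ay≢0  = no-split-edge wy (aw>0 , b-nbrs xw) (n≢0⇒n>0 ay≢0 , by>0)
      ...     | yes ay≡0 = m+1+n≰m S (≤-trans (S-small xw)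
                             (FullSplitEmpty.S-bound xw wy bx≡0 (aw>0 , b-nbrs xw) ay≡0 b-nbrs))

-- Single terms and witnesses in finite sums

≤-sum : ∀ {n} (f : Fin n → ℕ) i → f i ≤ sum f
≤-sum f zero    = m≤m+n (f zero) _
≤-sum f (suc i) = ≤-trans (≤-sum (f ∘ suc) i) (m≤n+m _ (f zero))

+-≤-sum : ∀ {n} (f : Fin n → ℕ) {i j} → i ≢ j → f i + f j ≤ sum f
+-≤-sum f {zero}  {zero}  i≢j = contradiction refl i≢j
+-≤-sum f {zero}  {suc j} i≢j = +-monoʳ-≤ (f zero) (≤-sum (f ∘ suc) j)
+-≤-sum f {suc i} {zero}  i≢j =
  ≤-trans (≤-reflexive (+-comm (f (suc i)) (f zero))) (+-monoʳ-≤ (f zero) (≤-sum (f ∘ suc) i))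
+-≤-sum f {suc i} {suc j} i≢j =
  ≤-trans (+-≤-sum (f ∘ suc) (i≢j ∘ cong suc)) (m≤n+m _ (f zero))

sum-positive : ∀ {n} (f : Fin n → ℕ) → 0 < sum f → ∃ λ i → 0 < f i
sum-positive {suc n} f Σ>0 with f zero in eq
... | suc _ = zero , subst (0 <_) (sym eq) z<s
... | zero with i , fi>0 ← sum-positive (f ∘ suc) Σ>0 = suc i , fi>0

-- Components, boundaries and degrees

module _ (K : Graph) where

  private
    V = Vertex K

  first-step : ∀ {x y} → Reachable K x y → x ≢ y → ∃ λ z → Adj K x z
  first-step ε       x≢x = contradiction refl x≢x
  first-step (p ◅ _) _   = _ , p

  -- A Boolean function instead of the predicate `Component`, so that its vertices can be counted.
  -- Soundness and closure together pin it down as the component of x.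
  IsComponent : V → (V → Bool) → Set
  IsComponent x χ = χ x ≡ true × (∀ y → χ y ≡ true → Reachable K x y) ×
                    (∀ {y z} → χ y ≡ true → Adj K y z → χ z ≡ true)

  -- Starting from x alone, add a vertex across an outgoing edge until there is none. The fuel k of
  -- `grow` bounds the number of vertices outside, which drops each time.
  component : ∀ x → ∃ (IsComponent x)
  component x = grow (Σᵥ K (𝟙 ∘ not ∘ ｛x｝)) ｛x｝ ≤-refl (dec-true (_≟ᵛ_ K x x) refl) sound₀
    where
    ｛x｝ : V → Bool
    ｛x｝ y = does (_≟ᵛ_ K y x)
    sound₀ : ∀ y → ｛x｝ y ≡ true → Reachable K x y
    sound₀ y eq = helper (_≟ᵛ_ K y x) eq
      where
      helper : (d : Dec (y ≡ x)) → does d ≡ true → Reachable K x y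
      helper (yes refl) _ = ε
    grow : ∀ k χ → Σᵥ K (𝟙 ∘ not ∘ χ) ≤ k → χ x ≡ true →
           (∀ y → χ y ≡ true → Reachable K x y) → ∃ (IsComponent x)
    grow k χ ∁χ≤k χx sound
      with any-vertex? K (λ y → any-vertex? K (λ z → (χ y Bool.≟ true) ×-dec adj? K y z ×-dec (χ z Bool.≟ false)))
    ... | no ¬p = χ , χx , sound , λ {y} {z} χy yz → Bool.¬-not (λ χz → ¬p (y , z , χy , yz , χz))
    ... | yes (y , z , χy , yz , χz) = extend k ∁χ≤k
      where
      χ′ : V → Bool
      χ′ w = does (_≟ᵛ_ K w z) ∨ χ w
      smaller : Σᵥ K (𝟙 ∘ not ∘ χ′) + 1 ≤ Σᵥ K (𝟙 ∘ not ∘ χ)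
      smaller = begin
        Σᵥ K (𝟙 ∘ not ∘ χ′) + 1
          ≡⟨ cong (Σᵥ K (𝟙 ∘ not ∘ χ′) +_) (Σᵥ-δ K z (λ _ → 1)) ⟨
        Σᵥ K (𝟙 ∘ not ∘ χ′) + Σᵥ K (λ w → δ K z w * 1)
          ≡⟨ Σᵥ-+ K (𝟙 ∘ not ∘ χ′) (λ w → δ K z w * 1) ⟨
        Σᵥ K (λ w → 𝟙 (not (χ′ w)) + δ K z w * 1)
          ≤⟨ Σᵥ-mono K (λ w → pointwise w (_≟ᵛ_ K w z)) ⟩
        Σᵥ K (𝟙 ∘ not ∘ χ) ∎
        where
        open ≤-Reasoning
        pointwise : ∀ w (d : Dec (w ≡ z)) → 𝟙 (not (does d ∨ χ w)) + 𝟙 (does d) * 1 ≤ 𝟙 (not (χ w))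
        pointwise w (yes refl) = ≤-reflexive (cong (𝟙 ∘ not) (sym χz))
        pointwise w (no _)     = ≤-reflexive (+-identityʳ _)
      sound′ : ∀ w → χ′ w ≡ true → Reachable K x w
      sound′ w = helper (_≟ᵛ_ K w z)
        where
        helper : (d : Dec (w ≡ z)) → does d ∨ χ w ≡ true → Reachable K x w
        helper (yes refl) _  = sound y χy ◅◅ (yz ◅ ε)
        helper (no _)     χw = sound w χw
      extend : ∀ k → Σᵥ K (𝟙 ∘ not ∘ χ) ≤ k → ∃ (IsComponent x)
      extend zero    ∁χ≤0 = contradiction (≤-trans smaller ∁χ≤0)
        (m+1+n≰m 0 ∘ subst (_≤ 0) (+-comm (Σᵥ K (𝟙 ∘ not ∘ χ′)) 1))
      extend (suc k) ∁χ≤k =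
        grow k χ′ (≤-pred (≤-trans (≤-reflexive (+-comm 1 (Σᵥ K (𝟙 ∘ not ∘ χ′)))) (≤-trans smaller ∁χ≤k)))
             (trans (cong (does (_≟ᵛ_ K x z) ∨_) χx) (Bool.∨-zeroʳ (does (_≟ᵛ_ K x z)))) sound′

  ∂ : (V → Bool) → EdgeSet K
  ∂ χ = record
    { Mem     = λ x y → Adj K x y × χ x ≢ χ y
    ; mem-sym = λ (xy , χx≢χy) → adj-sym K xy , χx≢χy ∘ sym
    ; mem?    = λ x y → adj? K x y ×-dec ¬? (χ x Bool.≟ χ y)
    ; mem⇒adj = proj₁
    }

  2*∣∂∣ : Simple K → ∀ χ → 2 * ∣ ∂ χ ∣ ≡ Σ² K (λ x y → e K x y * 𝟙 (χ x xor χ y))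
  2*∣∂∣ simple χ = trans (2*∣∣ K simple (∂ χ))
    (Σ²-cong K (λ x y → trans (𝟙-∧ (does (adj? K x y)) (not (does (χ x Bool.≟ χ y))))
                              (cong (λ b → e K x y * 𝟙 b) (≢-xor (χ x) (χ y)))))
    where
    ≢-xor : ∀ x y → not (does (x Bool.≟ y)) ≡ x xor y
    ≢-xor true  true  = refl
    ≢-xor true  false = refl
    ≢-xor false true  = refl
    ≢-xor false false = refl

  -- A walk avoiding the boundary keeps its colour, so the two colours are separated. The edge to a
  -- neighbour of the same colour survives, so no vertex becomes isolated.
  ∂-restricted : Simple K → ∀ χ → (∃ λ x → χ x ≡ true) → (∃ λ y → χ y ≡ false) →
    (∀ x → ∃ λ y → Adj K x y × χ y ≡ χ x) → IsRestrictedEdgeCut K (∂ χ)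
  ∂-restricted simple χ (x , χx) (y , χy) neighbour =
    (x , y , λ p → contradiction (trans (sym χx) (trans (preserved p) χy)) λ ()) ,
    λ u → let v , uv , χv≡χu = neighbour u in
      u , v , (λ u≡v → simple (subst (Adj K u) (sym u≡v) uv)) , ε , ((uv , λ (_ , χu≢χv) → χu≢χv (sym χv≡χu)) ◅ ε)
    where
    preserved : ∀ {u v} → Reachable (K ∖ ∂ χ) u v → χ u ≡ χ v
    preserved ε = refl
    preserved (_◅_ {u} {w} (uw , ¬mem) p) =
      trans (decidable-stable (χ u Bool.≟ χ w) (λ χu≢χw → ¬mem (uw , χu≢χw))) (preserved p)

  degree-positive : ∀ {x y} → Adj K x y → 1 ≤ degree K x
  degree-positive {x} {y} xy = begin
    1                          ≡⟨ e-adj K xy ⟨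
    e K x y                    ≡⟨ Σᵥ-δ K y (e K x) ⟨
    Σᵥ K (λ z → δ K y z * e K x z)
      ≤⟨ Σᵥ-mono K (λ z → *-monoˡ-≤ (e K x z) (δ≤1 z)) ⟩
    Σᵥ K (λ z → 1 * e K x z)   ≡⟨ Σᵥ-cong K (λ z → *-identityˡ (e K x z)) ⟩
    Σᵥ K (e K x)               ≡⟨ degree-Σᵥ K x ⟨
    degree K x                 ∎
    where
    open ≤-Reasoning
    𝟙≤1 : ∀ b → 𝟙 b ≤ 1
    𝟙≤1 true  = ≤-refl
    𝟙≤1 false = z≤n
    δ≤1 : ∀ z → δ K y z ≤ 1
    δ≤1 z = 𝟙≤1 (does (_≟ᵛ_ K z y))

  -- Both ends of an edge have positive degree, so the subtraction does not truncate.
  edgeDegree+2 : ∀ {x y} → Adj K x y → edgeDegree K x y + 2 ≡ degree K x + degree K y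
  edgeDegree+2 xy = m∸n+n≡m (+-mono-≤ (degree-positive xy) (degree-positive (adj-sym K xy)))

-- Colour indicators

⟦_is_⟧ : Bool → Bool → ℕ
⟦ x is β ⟧ = 𝟙 (does (x Bool.≟ β))

⟦is⟧-total : ∀ x β → ⟦ x is β ⟧ + ⟦ x is not β ⟧ ≡ 1
⟦is⟧-total true  true  = refl
⟦is⟧-total true  false = refl
⟦is⟧-total false true  = refl
⟦is⟧-total false false = refl

⟦is⟧-refl : ∀ {x β} → x ≡ β → ⟦ x is β ⟧ ≡ 1
⟦is⟧-refl {x} {β} eq = cong 𝟙 (dec-true (x Bool.≟ β) eq)

-- The shape of `cut` for single vertices, relative to a colour β so that later arguments serve both
-- colours.
𝟙-xor-is : ∀ x y β → 𝟙 (x xor y) ≡ ⟦ x is β ⟧ * ⟦ y is not β ⟧ + ⟦ x is not β ⟧ * ⟦ y is β ⟧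
𝟙-xor-is true  true  true  = refl
𝟙-xor-is true  true  false = refl
𝟙-xor-is true  false true  = refl
𝟙-xor-is true  false false = refl
𝟙-xor-is false true  true  = refl
𝟙-xor-is false true  false = refl
𝟙-xor-is false false true  = refl
𝟙-xor-is false false false = refl

-- Adjacency, sums and colour counts in the product

module Blowup (G : Graph) (n : ℕ) where

  H : Graph
  H = G ⊗ total n

  private
    V = Vertex G
    W = Vertex H

  H-simple : Simple G → Simple H
  H-simple simple (xx , _) = simple xx

  total-adj : ∀ i j → Adj (total n) i j
  total-adj i j with i Fin.≟ j
  ... | yes i≡j = inj₂ i≡j
  ... | no i≢j  = inj₁ i≢j

  lift-adj : ∀ {x y} → Adj G x y → ∀ i j → Adj H (x , i) (y , j)
  lift-adj xy i j = xy , total-adj i j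

  -- Any two vertices of `total n` are adjacent, so only the first coordinates matter.
  e-H : ∀ x y i j → e H (x , i) (y , j) ≡ e G x y
  e-H x y i j = trans (𝟙-∧ (does (adj? G x y)) (does (adj? (total n) i j)))
    (trans (cong (e G x y *_) (e-adj (total n) (total-adj i j))) (*-identityʳ (e G x y)))

  Σᵥ-H : (f : W → ℕ) → Σᵥ H f ≡ Σᵥ G (λ x → sum (λ i → f (x , i)))
  Σᵥ-H f = trans (sum-combine (order G) n (f ∘ Inverse.from (enum H)))
    (sum-cong-≗ (λ k → sum-cong-≗ (λ i →
      cong (λ (k , i) → f (Inverse.from (enum G) k , i)) (Fin.remQuot-combine k i))))

  Σ²-H : (f : W → W → ℕ) →
         Σ² H f ≡ Σ² G (λ x y → sum (λ i → sum (λ j → f (x , i) (y , j))))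
  Σ²-H f = trans (Σᵥ-H (λ p → Σᵥ H (f p)))
    (Σᵥ-cong G (λ x → trans (sum-cong-≗ (λ i → Σᵥ-H (f (x , i))))
      (∑-comm (λ i k → sum (λ j → f (x , i) (Inverse.from (enum G) k , j))))))

  count : Bool → (W → Bool) → V → ℕ
  count β χ x = sum (λ i → ⟦ χ (x , i) is β ⟧)

  count-total : ∀ β χ x → count β χ x + count (not β) χ x ≡ n
  count-total β χ x = begin
    count β χ x + count (not β) χ x
      ≡⟨ ∑-distrib-+ (λ i → ⟦ χ (x , i) is β ⟧) (λ i → ⟦ χ (x , i) is not β ⟧) ⟨
    sum (λ i → ⟦ χ (x , i) is β ⟧ + ⟦ χ (x , i) is not β ⟧)
      ≡⟨ sum-cong-≗ (λ i → ⟦is⟧-total (χ (x , i)) β) ⟩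
    sum {n} (λ _ → 1)  ≡⟨ sum-const n 1 ⟩
    n * 1              ≡⟨ *-identityʳ n ⟩
    n                  ∎
    where open ≡-Reasoning

  count-positive : ∀ {β χ x i} → χ (x , i) ≡ β → 0 < count β χ x
  count-positive {β} {χ} {x} {i} eq =
    ≤-trans (≤-reflexive (sym (⟦is⟧-refl eq))) (≤-sum (λ j → ⟦ χ (x , j) is β ⟧) i)

  count-witness : ∀ {β χ x} → 0 < count β χ x → ∃ λ i → χ (x , i) ≡ β
  count-witness {β} {χ} {x} count>0 with i , >0 ← sum-positive (λ j → ⟦ χ (x , j) is β ⟧) count>0 =
    i , helper (χ (x , i) Bool.≟ β) >0
    where
    helper : ∀ {b : Bool} (d : Dec (b ≡ β)) → 0 < 𝟙 (does d) → b ≡ β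
    helper (yes eq) _ = eq

  count-full : ∀ {β χ x} → count (not β) χ x ≡ 0 → ∀ i → χ (x , i) ≡ β
  count-full {β} {χ} {x} eq i = decidable-stable (χ (x , i) Bool.≟ β) λ χ≢β →
    contradiction eq (m<n⇒n≢0 (count-positive {not β} {χ} {x} (Bool.¬-not χ≢β)))

  count-unique : ∀ {β χ x i j} → count β χ x ≡ 1 → χ (x , i) ≡ β → χ (x , j) ≡ β → i ≡ j
  count-unique {β} {χ} {x} {i} {j} eq χi χj = decidable-stable (i Fin.≟ j) λ i≢j →
    contradiction (subst₂ _≤_ (cong₂ _+_ (⟦is⟧-refl χi) (⟦is⟧-refl χj)) eq
                    (+-≤-sum (λ j → ⟦ χ (x , j) is β ⟧) i≢j)) λ { (s≤s ()) }

  -- `𝟙-xor-is` turns each bichromatic test into products of one factor per fibre, so the double sum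
  -- over two fibres factors into colour counts.
  Σ²-xor : ∀ β χ → Σ² H (λ p q → e H p q * 𝟙 (χ p xor χ q)) ≡
                   Σ² G (λ x y → e G x y * cut G (count β χ) (count (not β) χ) x y)
  Σ²-xor β χ = trans (Σ²-H (λ p q → e H p q * 𝟙 (χ p xor χ q))) (Σ²-cong G fibre)
    where
    open ≡-Reasoning
    fibre : ∀ x y → sum (λ i → sum (λ j → e H (x , i) (y , j) * 𝟙 (χ (x , i) xor χ (y , j)))) ≡
                    e G x y * cut G (count β χ) (count (not β) χ) x y
    fibre x y = begin
      sum (λ i → sum (λ j → e H (x , i) (y , j) * 𝟙 (χ (x , i) xor χ (y , j))))
        ≡⟨ sum-cong-≗ (λ i → sum-cong-≗ (λ j →
             cong₂ _*_ (e-H x y i j) (𝟙-xor-is (χ (x , i)) (χ (y , j)) β))) ⟩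
      sum (λ i → sum (λ j → e G x y * (A x i * B y j + B x i * A y j)))
        ≡⟨ sum-cong-≗ (λ i → sym (*-distribˡ-sum (e G x y) (λ j → A x i * B y j + B x i * A y j))) ⟩
      sum (λ i → e G x y * sum (λ j → A x i * B y j + B x i * A y j))
        ≡⟨ *-distribˡ-sum (e G x y) (λ i → sum (λ j → A x i * B y j + B x i * A y j)) ⟨
      e G x y * sum (λ i → sum (λ j → A x i * B y j + B x i * A y j))
        ≡⟨ cong (e G x y *_) (sum-cong-≗ (λ i → ∑-distrib-+ (λ j → A x i * B y j) (λ j → B x i * A y j))) ⟩
      e G x y * sum (λ i → sum (λ j → A x i * B y j) + sum (λ j → B x i * A y j))
        ≡⟨ cong (e G x y *_) (∑-distrib-+ (λ i → sum (λ j → A x i * B y j)) (λ i → sum (λ j → B x i * A y j))) ⟩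
      e G x y * (sum (λ i → sum (λ j → A x i * B y j)) + sum (λ i → sum (λ j → B x i * A y j)))
        ≡⟨ cong (e G x y *_) (cong₂ _+_ (sum-* (A x) (B y)) (sum-* (B x) (A y))) ⟩
      e G x y * cut G (count β χ) (count (not β) χ) x y ∎
      where
      A B : V → Fin n → ℕ
      A x i = ⟦ χ (x , i) is β ⟧
      B x i = ⟦ χ (x , i) is not β ⟧

-- The restricted edge-cut isolating an edge over uv

module IsolatingEdge (G : Graph) (simple : Simple G) (conn : Connected G)
  (m : ℕ) {u v : Vertex G} (uv : Adj G u v) where

  private
    n : ℕ
    n = suc (suc m)
    V = Vertex G

  open Blowup G n

  neighbour : ∀ x → ∃ λ y → Adj G x y
  neighbour x with _≟ᵛ_ G x u
  ... | yes refl = v , uv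
  ... | no x≢u   = first-step G (conn x u) x≢u

  χ : Vertex H → Bool
  χ (x , zero)  = does (_≟ᵛ_ G x u) ∨ does (_≟ᵛ_ G x v)
  χ (x , suc i) = false

  χ-u : χ (u , zero) ≡ true
  χ-u = cong (_∨ does (_≟ᵛ_ G u v)) (dec-true (_≟ᵛ_ G u u) refl)

  χ-v : χ (v , zero) ≡ true
  χ-v = trans (cong (does (_≟ᵛ_ G v u) ∨_) (dec-true (_≟ᵛ_ G v v) refl)) (Bool.∨-zeroʳ (does (_≟ᵛ_ G v u)))

  same-side : ∀ p → ∃ λ q → Adj H p q × χ q ≡ χ p
  same-side (x , suc i) with y , xy ← neighbour x = (y , suc i) , lift-adj xy (suc i) (suc i) , refl
  same-side (x , zero)  = helper (_≟ᵛ_ G x u) (_≟ᵛ_ G x v)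
    where
    helper : Dec (x ≡ u) → Dec (x ≡ v) → ∃ λ q → Adj H (x , zero) q × χ q ≡ χ (x , zero)
    helper (yes refl) _          = (v , zero) , lift-adj uv zero zero , trans χ-v (sym χ-u)
    helper (no _)     (yes refl) = (u , zero) , lift-adj (adj-sym G uv) zero zero , trans χ-u (sym χ-v)
    -- The neighbour y may be u or v, so its copy is taken in layer `suc zero`, where nothing is
    -- coloured `true`.
    helper (no x≢u)   (no x≢v) with y , xy ← neighbour x =
      (y , suc zero) , lift-adj xy zero (suc zero) ,
      sym (cong₂ _∨_ (dec-false (_≟ᵛ_ G x u) x≢u) (dec-false (_≟ᵛ_ G x v) x≢v))

  restricted : IsRestrictedEdgeCut H (∂ H χ)
  restricted = ∂-restricted H (H-simple simple) χ ((u , zero) , χ-u) ((u , suc zero) , refl) same-side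

  count-s : ∀ x → count true χ x ≡ s G u v x
  count-s x = trans (sum-single {f = λ i → ⟦ χ (x , i) is true ⟧} zero
                      λ { zero 0≢0 → contradiction refl 0≢0 ; (suc i) _ → refl })
                    (helper (_≟ᵛ_ G x u) (_≟ᵛ_ G x v))
    where
    helper : (d : Dec (x ≡ u)) (d′ : Dec (x ≡ v)) →
             ⟦ does d ∨ does d′ is true ⟧ ≡ 𝟙 (does d) + 𝟙 (does d′)
    helper (yes refl) (yes refl) = contradiction uv simple
    helper (yes _)    (no _)     = refl
    helper (no _)     (yes _)    = refl
    helper (no _)     (no _)     = refl

  -- Here a = `s G u v`, and the bound `ends≤cut` becomes an identity: a x · b y + b x · a y + 2 · a
  -- x · a y = n · (a x + a y), because a + b = n in both fibres.
  2*∣∂χ∣+4 : 2 * ∣ ∂ H χ ∣ + 4 ≡ n * (2 * (degree G u + degree G v))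
  2*∣∂χ∣+4 = begin
    2 * ∣ ∂ H χ ∣ + 4
      ≡⟨ cong₂ _+_ (trans (2*∣∂∣ H (H-simple simple) χ) (Σ²-xor true χ))
                   (sym (trans (Σ²-* G 2 (inner G u v)) (cong (2 *_) (Σ²-inner G simple uv)))) ⟩
    Σ² G (λ x y → e G x y * cut G a b x y) + Σ² G (λ x y → 2 * inner G u v x y)
      ≡⟨ Σ²-+ G (λ x y → e G x y * cut G a b x y) (λ x y → 2 * inner G u v x y) ⟨
    Σ² G (λ x y → e G x y * cut G a b x y + 2 * inner G u v x y)
      ≡⟨ Σ²-cong G pointwise ⟩
    Σ² G (λ x y → n * ends G u v x y)
      ≡⟨ trans (Σ²-* G n (ends G u v)) (cong (n *_) (Σ²-ends G u v)) ⟩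
    n * (2 * (degree G u + degree G v)) ∎
    where
    open ≡-Reasoning
    a b : V → ℕ
    a = count true χ
    b = count false χ
    expand : ∀ e p q r t → e * (p * t + q * r) + 2 * (e * (p * r)) ≡ e * ((r + t) * p + (p + q) * r)
    expand = solve-∀
    collect : ∀ n e p r → e * (n * p + n * r) ≡ n * (e * (p + r))
    collect = solve-∀
    pointwise : ∀ x y → e G x y * cut G a b x y + 2 * inner G u v x y ≡ n * ends G u v x y
    pointwise x y = begin
      e G x y * (a x * b y + b x * a y) + 2 * (e G x y * (s G u v x * s G u v y))
        ≡⟨ cong₂ (λ i j → e G x y * (a x * b y + b x * a y) + 2 * (e G x y * (i * j))) (count-s x) (count-s y) ⟨
      e G x y * (a x * b y + b x * a y) + 2 * (e G x y * (a x * a y))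
        ≡⟨ expand (e G x y) (a x) (b x) (a y) (b y) ⟩
      e G x y * ((a y + b y) * a x + (a x + b x) * a y)
        ≡⟨ cong₂ (λ i j → e G x y * (i * a x + j * a y)) (count-total true χ y) (count-total true χ x) ⟩
      e G x y * (n * a x + n * a y)
        ≡⟨ collect n (e G x y) (a x) (a y) ⟩
      n * (e G x y * (a x + a y))
        ≡⟨ cong₂ (λ i j → n * (e G x y * (i + j))) (count-s x) (count-s y) ⟩
      n * (e G x y * (s G u v x + s G u v y)) ∎

-- Two-colouring a disconnected graph

module _ (K : Graph) where

  -- Colour the component of p₀ with `true`; q₀ lies outside it. Symmetry of adjacency makes the
  -- complement closed as well.
  disconnected⇒colouring : Disconnected K → ∃ λ (χ : Vertex K → Bool) →
    (∀ β {p q} → χ p ≡ β → Adj K p q → χ q ≡ β) × (∀ β → ∃ λ p → χ p ≡ β)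
  disconnected⇒colouring (p₀ , q₀ , unreachable) with component K p₀
  ... | χ , χp₀ , sound , closed = χ , preserves , inhabited
    where
    preserves : ∀ β {p q} → χ p ≡ β → Adj K p q → χ q ≡ β
    preserves true  χp pq = closed χp pq
    preserves false χp pq = Bool.¬-not λ χq →
      contradiction (trans (sym χp) (closed χq (adj-sym K pq))) λ ()
    inhabited : ∀ β → ∃ λ p → χ p ≡ β
    inhabited true  = p₀ , χp₀
    inhabited false = q₀ , Bool.¬-not (λ χq₀ → unreachable (sound q₀ χq₀))

  -- Of two distinct reachable vertices at least one differs from p, and the walk to it has a first
  -- edge.
  nontrivial-component⇒neighbour : ∀ {p} → (∃₂ λ y z → y ≢ z × Component K p y × Component K p z) →
                                   ∃ λ q → Adj K p q
  nontrivial-component⇒neighbour (_ , _ , y≢z , ε       , ε)       = contradiction refl y≢z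
  nontrivial-component⇒neighbour (_ , _ , y≢z , ε       , (r ◅ _)) = _ , r
  nontrivial-component⇒neighbour (_ , _ , y≢z , (r ◅ _) , _)       = _ , r

-- A colouring constant on the components of `H ∖ F`

module Colouring (G : Graph) (simple : Simple G) (conn : Connected G) (n : ℕ) (n≥3 : 3 ≤ n)
  (F : EdgeSet (G ⊗ total n))
  (χ : Vertex (G ⊗ total n) → Bool)
  (preserves : ∀ β {p q} → χ p ≡ β → Adj ((G ⊗ total n) ∖ F) p q → χ q ≡ β)
  (side-inhabited : ∀ β → ∃ λ p → χ p ≡ β)
  (neighbour : ∀ p → ∃ λ q → Adj ((G ⊗ total n) ∖ F) p q) where

  open Blowup G n

  private
    V = Vertex G

    preserves* : ∀ {p q} β → χ p ≡ β → Reachable (H ∖ F) p q → χ q ≡ β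
    preserves* β χp ε       = χp
    preserves* β χp (r ◅ p) = preserves* β (preserves β χp r) p

    same-side : ∀ β p → χ p ≡ β → ∃ λ q → Adj H p q × χ q ≡ β
    same-side β p χp with q , pq ← neighbour p = q , proj₁ pq , preserves β χp pq

  -- The neighbour that p keeps in `H ∖ F` has colour β, so it can only be q, and the component of p
  -- cannot leave its colour class.
  two-element-side⇒IsolatesEdge : ∀ {p q} β → χ p ≡ β →
    (∀ r → χ r ≡ β → r ≡ p ⊎ r ≡ q) → IsolatesEdge H F
  two-element-side⇒IsolatesEdge {p} {q} β χp only with neighbour p
  ... | r , pr with only r (preserves β χp pr)
  ...   | inj₁ refl = contradiction (proj₁ pr) (H-simple simple {p})
  ...   | inj₂ refl = p , p , r , (λ { refl → H-simple simple {p} (proj₁ pr) }) , pr , ⊆ , ⊇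
    where
    ⊆ : ∀ {t} → Component (H ∖ F) p t → (｛ p ｝ ∪ ｛ r ｝) t
    ⊆ {t} path with only t (preserves* β χp path)
    ... | inj₁ t≡p = inj₁ (sym t≡p)
    ... | inj₂ t≡r = inj₂ (sym t≡r)
    ⊇ : ∀ {t} → (｛ p ｝ ∪ ｛ r ｝) t → Component (H ∖ F) p t
    ⊇ (inj₁ refl) = ε
    ⊇ (inj₂ refl) = pr ◅ ε

  private
    module P (β : Bool) = Profile G simple n n≥3 (count β χ) (count (not β) χ) (count-total β χ)

    -- Every bichromatic edge lies in `F`, since the edges outside `F` preserve colours.
    S≤2*∣F∣ : ∀ β → P.S β ≤ 2 * ∣ F ∣
    S≤2*∣F∣ β = begin
      P.S β                                        ≡⟨ Σ²-xor β χ ⟨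
      Σ² H (λ p q → e H p q * 𝟙 (χ p xor χ q))     ≤⟨ Σ²-mono H (λ p q → pointwise p q (adj? H p q) (mem? F p q)) ⟩
      Σ² H (λ p q → 𝟙 (does (mem? F p q)))         ≡⟨ 2*∣∣ H (H-simple simple) F ⟨
      2 * ∣ F ∣                                    ∎
      where
      open ≤-Reasoning
      xor≤1 : ∀ x y → 1 * 𝟙 (x xor y) ≤ 1
      xor≤1 true  true  = z≤n
      xor≤1 true  false = ≤-refl
      xor≤1 false true  = ≤-refl
      xor≤1 false false = z≤n
      xor-same : ∀ {x y} → x ≡ y → 1 * 𝟙 (x xor y) ≡ 0
      xor-same {true}  refl = refl
      xor-same {false} refl = refl
      pointwise : ∀ p q (d : Dec (Adj H p q)) (d′ : Dec (Mem F p q)) →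
        𝟙 (does d) * 𝟙 (χ p xor χ q) ≤ 𝟙 (does d′)
      pointwise p q (no _)   _         = z≤n
      pointwise p q (yes _)  (yes _)   = xor≤1 (χ p) (χ q)
      pointwise p q (yes pq) (no pq∉F) = ≤-reflexive (xor-same (sym (preserves (χ p) refl (pq , pq∉F))))

    pair⇒IsolatesEdge : ∀ β {u v} → P.Pair β u v → IsolatesEdge H F
    pair⇒IsolatesEdge β {u} {v} (u≡1 , v≡1 , rest≡0)
      with count-witness {β} {χ} {u} (≤-reflexive (sym u≡1)) | count-witness {β} {χ} {v} (≤-reflexive (sym v≡1))
    ... | i , χu | j , χv = two-element-side⇒IsolatesEdge β χu only
      where
      only : ∀ r → χ r ≡ β → r ≡ (u , i) ⊎ r ≡ (v , j)
      only (x , k) χx with _≟ᵛ_ G x u | _≟ᵛ_ G x v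
      ... | yes refl | _        = inj₁ (cong (u ,_) (count-unique {β} {χ} u≡1 χx χu))
      ... | no _     | yes refl = inj₂ (cong (v ,_) (count-unique {β} {χ} v≡1 χx χv))
      ... | no x≢u   | no x≢v   =
        contradiction (rest≡0 x x≢u x≢v) (m<n⇒n≢0 (count-positive {β} {χ} χx))

    unsplit : ∀ β {x} → P.Split β x → P.Split true x
    unsplit true  split     = split
    unsplit false (a , b)   = b , a

  -- Slices when no edge is split at both ends

  module NoSplitEdge
    (no-split-edge : ∀ {x y} → Adj G x y → P.Split true x → ¬ P.Split true y)
    (F-small : ∀ {x y} → Adj G x y → 2 * ∣ F ∣ + 4 ≤ n * (2 * (degree G x + degree G y))) where

    private
      no-split : ∀ β {x y} → Adj G x y → P.Split β x → ¬ P.Split β y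
      no-split β xy x-split y-split = no-split-edge xy (unsplit β x-split) (unsplit β y-split)

      count-neighbour : ∀ β {x} → 0 < count β χ x → ∃ λ y → Adj G x y × 0 < count β χ y
      count-neighbour β {x} pos with count-witness {β} {χ} {x} pos
      ... | i , χx with same-side β (x , i) χx
      ...   | (y , j) , xy , χy = y , proj₁ xy , count-positive {β} {χ} χy

      -- Over a monochromatic fibre this is `Full.full-neighbour`. Over a split fibre, any
      -- neighbouring fibre that meets β is not split, hence entirely of colour β.
      full-neighbour-of : ∀ β {x i} → χ (x , i) ≡ β → ∃ λ y → Adj G x y × count (not β) χ y ≡ 0
      full-neighbour-of β {x} {i} χx with count (not β) χ x ≟ 0
      ... | yes full = Full.full-neighbour G simple n n≥3 (count β χ) (count (not β) χ) (count-total β χ)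
              (no-split β) (count-neighbour β) (count-neighbour (not β))
              (λ xy → ≤-trans (+-monoˡ-≤ 4 (S≤2*∣F∣ β)) (F-small xy)) full
      ... | no ¬full with count-neighbour β (count-positive {β} {χ} χx)
      ...   | y , xy , y>0 = y , xy , decidable-stable (count (not β) χ y ≟ 0) λ ¬y-full →
              no-split β xy (count-positive {β} {χ} χx , n≢0⇒n>0 ¬full) (y>0 , n≢0⇒n>0 ¬y-full)

    slice : Fin n → V → Bool
    slice i x = χ (x , i)

    private
      slice-inhabited : ∀ i β → ∃ λ x → slice i x ≡ β
      slice-inhabited i β with side-inhabited β
      ... | (x , j) , χx with full-neighbour-of β χx
      -- A fibre entirely of colour β meets every slice in that colour.
      ...   | y , _ , full = y , count-full {β} {χ} full i

    -- A neighbouring fibre entirely of the colour of (x , i) gives x a neighbour of its own colour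
    -- within slice i.
    slice-restricted : ∀ i → IsRestrictedEdgeCut G (∂ G (slice i))
    slice-restricted i = ∂-restricted G simple (slice i) (slice-inhabited i true) (slice-inhabited i false) neighbours
      where
      neighbours : ∀ x → ∃ λ y → Adj G x y × slice i y ≡ slice i x
      neighbours x with full-neighbour-of (slice i x) refl
      ... | y , xy , full = y , xy , count-full {slice i x} {χ} full i

    private
      -- Over a fibre x of the single colour β, both sides are n times the number of vertices over y
      -- of the other colour.
      slices-full : ∀ β x y → count (not β) χ x ≡ 0 →
        n * sum (λ i → 𝟙 (slice i x xor slice i y)) ≡ cut G (count true χ) (count false χ) x y
      slices-full β x y full = begin
        n * sum (λ i → 𝟙 (slice i x xor slice i y))
          ≡⟨ cong (n *_) (sum-cong-≗ pointwise) ⟩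
        n * count (not β) χ y
          ≡⟨ cong (_* count (not β) χ y) (trans (sym (+-identityʳ _))
               (trans (cong (count β χ x +_) (sym full)) (count-total β χ x))) ⟨
        count β χ x * count (not β) χ y
          ≡⟨ +-identityʳ _ ⟨
        count β χ x * count (not β) χ y + 0 * count β χ y
          ≡⟨ cong (λ k → count β χ x * count (not β) χ y + k * count β χ y) full ⟨
        cut G (count β χ) (count (not β) χ) x y
          ≡⟨ orient β ⟩
        cut G (count true χ) (count false χ) x y ∎
        where
        open ≡-Reasoning
        orient : ∀ β → cut G (count β χ) (count (not β) χ) x y ≡ cut G (count true χ) (count false χ) x y
        orient true  = refl
        orient false = +-comm (count false χ x * count true χ y) _
        xor-is : ∀ β {b} c → b ≡ β → 𝟙 (b xor c) ≡ ⟦ c is not β ⟧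
        xor-is true  true  refl = refl
        xor-is true  false refl = refl
        xor-is false true  refl = refl
        xor-is false false refl = refl
        pointwise : ∀ i → 𝟙 (slice i x xor slice i y) ≡ ⟦ χ (y , i) is not β ⟧
        pointwise i = xor-is β (χ (y , i)) (count-full {β} {χ} full i)

      -- One end of the edge is monochromatic, in one of two colours; symmetry in x and y reduces
      -- the four cases to `slices-full`.
      slices-adj : ∀ {x y} → Adj G x y →
        n * sum (λ i → 𝟙 (slice i x xor slice i y)) ≡ cut G (count true χ) (count false χ) x y
      slices-adj {x} {y} xy = cases (count false χ x ≟ 0) (count true χ x ≟ 0) (count false χ y ≟ 0) (count true χ y ≟ 0)
        where
        flip : n * sum (λ i → 𝟙 (slice i y xor slice i x)) ≡ cut G (count true χ) (count false χ) y x →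
               n * sum (λ i → 𝟙 (slice i x xor slice i y)) ≡ cut G (count true χ) (count false χ) x y
        flip eq = trans (cong (n *_) (sum-cong-≗ (λ i → cong 𝟙 (Bool.xor-comm (slice i x) (slice i y)))))
                        (trans eq (cut-sym G (count true χ) (count false χ) y x))
        cases : Dec (count false χ x ≡ 0) → Dec (count true χ x ≡ 0) →
                Dec (count false χ y ≡ 0) → Dec (count true χ y ≡ 0) →
                n * sum (λ i → 𝟙 (slice i x xor slice i y)) ≡ cut G (count true χ) (count false χ) x y
        cases (yes full) _ _ _ = slices-full true x y full
        cases _ (yes full) _ _ = slices-full false x y full
        cases _ _ (yes full) _ = flip (slices-full true y x full)
        cases _ _ _ (yes full) = flip (slices-full false y x full)
        cases (no fx) (no tx) (no fy) (no ty) =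
          contradiction (n≢0⇒n>0 ty , n≢0⇒n>0 fy) (no-split-edge xy (n≢0⇒n>0 tx , n≢0⇒n>0 fx))

    slices≤S : n * sum (λ i → 2 * ∣ ∂ G (slice i) ∣) ≤ P.S true
    slices≤S = begin
      n * sum (λ i → 2 * ∣ ∂ G (slice i) ∣)
        ≡⟨ cong (n *_) (sum-cong-≗ (λ i → 2*∣∂∣ G simple (slice i))) ⟩
      n * sum (λ i → Σ² G (λ x y → e G x y * X x y i))
        ≡⟨ cong (n *_) (∑-comm (λ i k → Σᵥ G (λ y → e G (at k) y * X (at k) y i))) ⟩
      n * Σᵥ G (λ x → sum (λ i → Σᵥ G (λ y → e G x y * X x y i)))
        ≡⟨ cong (n *_) (Σᵥ-cong G (λ x → ∑-comm (λ i k → e G x (at k) * X x (at k) i))) ⟩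
      n * Σ² G (λ x y → sum (λ i → e G x y * X x y i))
        ≡⟨ Σ²-* G n (λ x y → sum (λ i → e G x y * X x y i)) ⟨
      Σ² G (λ x y → n * sum (λ i → e G x y * X x y i))
        ≤⟨ Σ²-mono G (λ x y → ≤-trans
             (≤-reflexive (trans (cong (n *_) (sym (*-distribˡ-sum (e G x y) (X x y)))) (rearrange n (e G x y) (sum (X x y)))))
             (pointwise x y (adj? G x y))) ⟩
      P.S true ∎
      where
      open ≤-Reasoning
      at = Inverse.from (enum G)
      X : V → V → Fin n → ℕ
      X x y i = 𝟙 (slice i x xor slice i y)
      rearrange : ∀ n e x → n * (e * x) ≡ e * (n * x)
      rearrange = solve-∀
      pointwise : ∀ x y (d : Dec (Adj G x y)) →
        𝟙 (does d) * (n * sum (X x y)) ≤ 𝟙 (does d) * cut G (count true χ) (count false χ) x y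
      pointwise x y (yes xy) = *-monoʳ-≤ 1 (≤-reflexive (slices-adj xy))
      pointwise x y (no _)   = z≤n

    slices-bound : ∀ k → (∀ i → k ≤ ∣ ∂ G (slice i) ∣) → n * (n * (2 * k)) ≤ 2 * ∣ F ∣
    slices-bound k k≤ = begin
      n * (n * (2 * k))                        ≡⟨ cong (n *_) (sum-const n (2 * k)) ⟨
      n * sum {n} (λ _ → 2 * k)                ≤⟨ *-monoʳ-≤ n (sum-mono (λ i → *-monoʳ-≤ 2 (k≤ i))) ⟩
      n * sum (λ i → 2 * ∣ ∂ G (slice i) ∣)    ≤⟨ slices≤S ⟩
      P.S true                                 ≤⟨ S≤2*∣F∣ true ⟩
      2 * ∣ F ∣                                ∎
      where open ≤-Reasoning

  -- The case distinction on split edges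

  module _
    (F-small : ∀ {x y} → Adj G x y → 2 * ∣ F ∣ + 4 ≤ n * (2 * (degree G x + degree G y))) where

    isolates-edge : ∀ ξ → 2 * ∣ F ∣ + 4 ≤ n * (2 * (ξ + 2)) →
      ∀ {l} → IsRestrictedEdgeConnectivity G l → [ n * ξ + 2 * (n ∸ 1) ] <⁺ (n ^ 2) ·⁺ l →
      IsolatesEdge H F
    isolates-edge ξ F≤ λ′ λ′-large
      with any-vertex? G (λ x → any-vertex? G (λ y → adj? G x y ×-dec split? x ×-dec split? y))
      where
      split? : ∀ x → Dec (P.Split true x)
      split? x = (0 <? count true χ x) ×-dec (0 <? count false χ x)
    ... | yes (x , y , xy , x-split , y-split) =
      conclude (SplitEdge.splitEdge⇒Pair G simple n n≥3 (count true χ) (count false χ) (count-total true χ)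
                 conn xy x-split y-split (≤-trans (+-monoˡ-≤ 4 (S≤2*∣F∣ true)) (F-small xy)))
      where
      conclude : P.Pair true x y ⊎ _ → IsolatesEdge H F
      conclude (inj₁ pair) = pair⇒IsolatesEdge true pair
      conclude (inj₂ pair) = pair⇒IsolatesEdge false pair
    ... | no ¬split-edge = ⊥-elim (absurd λ′ λ′-large)
      where
      open NoSplitEdge (λ xy x-split y-split → ¬split-edge (_ , _ , xy , x-split , y-split)) F-small
      -- m stands for n - 1, and n * (n * 1) is what n ^ 2 unfolds to. The extra 2 below is the
      -- strictness of the hypothesis, doubled.
      too-large : ∀ m k → n ≡ suc m → n * ξ + 2 * m < n * (n * 1) * k → n * (n * (2 * k)) ≤ 2 * ∣ F ∣ → ⊥
      too-large m k n≡1+m ξ<k k≤F = m+1+n≰m (2 * ∣ F ∣ + 4) (begin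
        2 * ∣ F ∣ + 4 + 2                  ≤⟨ +-monoˡ-≤ 2 F≤ ⟩
        n * (2 * (ξ + 2)) + 2              ≡⟨ expand n ξ ⟩
        2 * (n * ξ) + (4 * n + 2)          ≡⟨ cong (λ n′ → 2 * (n * ξ) + (4 * n′ + 2)) n≡1+m ⟩
        2 * (n * ξ) + (4 * suc m + 2)      ≡⟨ collect (n * ξ) m ⟩
        2 * suc (n * ξ + 2 * m) + 4        ≤⟨ +-monoˡ-≤ 4 (*-monoʳ-≤ 2 ξ<k) ⟩
        2 * (n * (n * 1) * k) + 4          ≡⟨ rearrange n k ⟩
        n * (n * (2 * k)) + 4              ≤⟨ +-monoˡ-≤ 4 k≤F ⟩
        2 * ∣ F ∣ + 4                      ∎)
        where
        open ≤-Reasoning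
        expand : ∀ n ξ → n * (2 * (ξ + 2)) + 2 ≡ 2 * (n * ξ) + (4 * n + 2)
        expand = solve-∀
        collect : ∀ x m → 2 * x + (4 * suc m + 2) ≡ 2 * suc (x + 2 * m) + 4
        collect = solve-∀
        rearrange : ∀ n k → 2 * (n * (n * 1) * k) + 4 ≡ n * (n * (2 * k)) + 4
        rearrange = solve-∀
      absurd : ∀ {l} → IsRestrictedEdgeConnectivity G l → [ n * ξ + 2 * (n ∸ 1) ] <⁺ (n ^ 2) ·⁺ l → ⊥
      -- When λ′(G) is infinite, a single slice already is a forbidden restricted edge-cut; layer 0
      -- serves.
      absurd (infinite no-cut) _ = no-cut (∂ G (slice i)) (slice-restricted i)
        where
        i : Fin n
        i = Fin.fromℕ< (≤-trans (s≤s z≤n) n≥3)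
      absurd (finite F₀ (_ , F₀-min)) ξ<k =
        too-large (n ∸ 1) ∣ F₀ ∣ (sym (m+[n∸m]≡n {1} (≤-trans (s≤s z≤n) n≥3))) ([<]-injective ξ<k)
          (slices-bound ∣ F₀ ∣ (λ i → F₀-min (∂ G (slice i)) (slice-restricted i)))

theorem3p3 : (G : Graph) → Simple G → Nontrivial G → Connected G →
    (n : ℕ) → 3 ≤ n →
    (ξ : ℕ) → IsMinEdgeDegree G ξ →
    (l : ℕ ⁺) → IsRestrictedEdgeConnectivity G l →
    [ n * ξ + 2 * (n ∸ 1) ] <⁺ (n ^ 2) ·⁺ l →
    SuperRestrictedEdgeConnected (G ⊗ total n)
theorem3p3 G simple _ conn (suc zero) (s≤s ())
theorem3p3 G simple _ conn n@(suc (suc m)) n≥3 ξ ((u , v , uv , uv-ξ) , ξ-min) l λ′ λ′-large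
  F ((disc , nontrivial) , F-min)
  with χ , preserves , inhabited ← disconnected⇒colouring ((G ⊗ total n) ∖ F) disc =
  Colouring.isolates-edge G simple conn n n≥3 F χ preserves inhabited
    (λ p → nontrivial-component⇒neighbour ((G ⊗ total n) ∖ F) (nontrivial p))
    -- Every edge has degree sum at least ξ + 2, so the bound from a minimising edge applies to all
    -- edges.
    (λ xy → ≤-trans F≤ (*-monoʳ-≤ n (*-monoʳ-≤ 2
      (≤-trans (+-monoˡ-≤ 2 (ξ-min xy)) (≤-reflexive (edgeDegree+2 G xy))))))
    ξ F≤ λ′ λ′-large
  where
  open IsolatingEdge G simple conn m uv using (restricted; 2*∣∂χ∣+4) renaming (χ to χ₀)
  -- This is |F| ≤ nξ + 2(n - 1), doubled and with the subtraction cleared.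
  F≤ : 2 * ∣ F ∣ + 4 ≤ n * (2 * (ξ + 2))
  F≤ = begin
    2 * ∣ F ∣ + 4                        ≤⟨ +-monoˡ-≤ 4 (*-monoʳ-≤ 2 (F-min (∂ (G ⊗ total n) χ₀) restricted)) ⟩
    2 * ∣ ∂ (G ⊗ total n) χ₀ ∣ + 4       ≡⟨ 2*∣∂χ∣+4 ⟩
    n * (2 * (degree G u + degree G v))
      ≡⟨ cong (λ k → n * (2 * k)) (trans (sym (edgeDegree+2 G uv)) (cong (_+ 2) uv-ξ)) ⟩
    n * (2 * (ξ + 2))                    ∎
    where open ≤-Reasoning
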